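{- There exist linear reductions in both directions between the Maximum Consecutive Subsums Problem (MCSP) and the $(\min,+)$-convolution problem. That is, any instance of either problem of size $n$ can be transformed in $O(n)$ time into an instance of size $O(n)$ of the other problem, such that the solution of the original instance can be recovered in $O(n)$ time from the solution of the transformed instance. Consequently the two problems have the same time complexity up to additive and multiplicative linear terms.
   Context: MCSP: given a sequence $A=(a_1,\dots,a_n)$ of real numbers, compute $m_1,\dots,m_n$ where $m_\ell=\max_{i=1,\dots,n-\ell+1}\{a_i+\dots+a_{i+\ell-1}\}$ (equivalently, for each $\ell$ a starting position $p_\ell$ of a consecutive block of length $\ell$ attaining this maximum). $(\min,+)$-convolution: given real sequences $X=(x_0,\dots,x_n)$ and $Y=(y_0,\dots,y_n)$, compute $z_0,\dots,z_{2n}$ where $z_k=\min\{x_i+y_{k-i}\}$ over all indices $i$ with $0\le i\le n$ and $0\le k-i\le n$. -}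

module Defs where

open import Algebra.Bundles using (CommutativeRing)
import Algebra.Properties.CommutativeMonoid.Sum as Sum
open import Data.Bool.Base using (if_then_else_)
open import Data.Fin.Base using (Fin; toℕ; inject≤; _↑ʳ_)
open import Data.Nat as ℕ using (ℕ; zero; suc; _∸_; _⊔_)
open import Data.Product using (Σ; ∃; ∃-syntax; _×_; _,_)
open import Data.Vec.Functional using (Vector)
import Level as L
open import Relation.Binary.Core using (Rel)
open import Relation.Binary.Structures using (IsDecTotalOrder)
open import Relation.Binary.PropositionalEquality.Core using (_≡_)
open import Relation.Nullary using (¬_; does)

-- ℝ is not in the library, so everything below is over an arbitrary ordered
-- field with decidable order, of which the real numbers of classical
-- mathematics are an instance.  Decidability is what lets a machine branch on
-- a comparison.  The value of 0# ⁻¹ is irrelevant: the machine below never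
-- divides by zero.
record OrderedField c ℓ₁ ℓ₂ : Set (L.suc (c L.⊔ ℓ₁ L.⊔ ℓ₂)) where
  infix 4 _≤_
  infix 8 _⁻¹
  field
    commutativeRing : CommutativeRing c ℓ₁
  open CommutativeRing commutativeRing public
  field
    _≤_             : Rel Carrier ℓ₂
    isDecTotalOrder : IsDecTotalOrder _≈_ _≤_
    +-monoˡ-≤       : ∀ z {x y} → x ≤ y → (x + z) ≤ (y + z)
    *-nonNegative   : ∀ {x y} → 0# ≤ x → 0# ≤ y → 0# ≤ (x * y)
    0≉1             : ¬ (0# ≈ 1#)
    _⁻¹             : Carrier → Carrier
    ⁻¹-inverseʳ     : ∀ x → ¬ (x ≈ 0#) → (x * x ⁻¹) ≈ 1#

------------------------------------------------------------------------
-- Programs of a real random access machine.  Memory consists of index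
-- registers holding natural numbers, arrays of natural numbers and arrays of
-- reals.  Registers and arrays are named by numerals occurring in the program
-- text, so a program uses finitely many of them; arrays are indexed by
-- registers, which provides indirect addressing.

Reg Arr : Set
Reg = ℕ
Arr = ℕ

data IndexOp : Set where
  add monus : IndexOp

data RealOp : Set where
  add sub mul div : RealOp

record Cell : Set where
  constructor _[_]
  field
    array : Arr
    index : Reg

data Instr : Set where
  constᵢ : (i : Reg) → ℕ → Instr
  opᵢ    : IndexOp → (i j k : Reg) → Instr          -- i ≔ j op k
  loadᵢ  : (i : Reg) → Cell → Instr
  storeᵢ : Cell → (i : Reg) → Instr
  zeroᵣ  : Cell → Instr
  oneᵣ   : Cell → Instr
  moveᵣ  : (target source : Cell) → Instr
  opᵣ    : RealOp → (target left right : Cell) → Instr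

data Test : Set where
  _≤ᵢ_ : (i j : Reg) → Test
  _≤ᵣ_ : (left right : Cell) → Test

infixr 5 _⨾_
data Prog : Set where
  skip            : Prog
  instr           : Instr → Prog
  _⨾_             : Prog → Prog → Prog
  when_then_else_ : Test → Prog → Prog → Prog
  while_repeat_   : Test → Prog → Prog

_[_↦_] : ∀ {a} {A : Set a} → (ℕ → A) → ℕ → A → (ℕ → A)
(f [ i ↦ x ]) j = if does (i ℕ.≟ j) then x else f j

maxUpTo : (ℕ → ℕ) → ℕ → ℕ
maxUpTo T zero    = T zero
maxUpTo T (suc n) = maxUpTo T n ⊔ T (suc n)

module RealRAM {c ℓ₁ ℓ₂} (R : OrderedField c ℓ₁ ℓ₂) where

  open OrderedField R
    using (Carrier; _≈_; _≤_; _+_; _-_; _*_; _⁻¹; 0#; 1#; +-commutativeMonoid)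
  open Sum +-commutativeMonoid using (sum)

  record State : Set c where
    field
      regs    : Reg → ℕ
      indices : Arr → ℕ → ℕ
      reals   : Arr → ℕ → Carrier
  open State

  setReg : Reg → ℕ → State → State
  setReg i v s = record s { regs = regs s [ i ↦ v ] }

  getIndex : Cell → State → ℕ
  getIndex (a [ i ]) s = indices s a (regs s i)

  setIndex : Cell → ℕ → State → State
  setIndex (a [ i ]) v s =
    record s { indices = indices s [ a ↦ indices s a [ regs s i ↦ v ] ] }

  getReal : Cell → State → Carrier
  getReal (a [ i ]) s = reals s a (regs s i)

  setReal : Cell → Carrier → State → State
  setReal (a [ i ]) v s =
    record s { reals = reals s [ a ↦ reals s a [ regs s i ↦ v ] ] }

  ⟦_⟧ᵢ : IndexOp → ℕ → ℕ → ℕ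
  ⟦ add   ⟧ᵢ = ℕ._+_
  ⟦ monus ⟧ᵢ = _∸_

  ⟦_⟧ᵣ : RealOp → Carrier → Carrier → Carrier
  ⟦ add ⟧ᵣ x y = x + y
  ⟦ sub ⟧ᵣ x y = x - y
  ⟦ mul ⟧ᵣ x y = x * y
  ⟦ div ⟧ᵣ x y = x * y ⁻¹

  exec : Instr → State → State
  exec (constᵢ i n)    s = setReg i n s
  exec (opᵢ o i j k)   s = setReg i (⟦ o ⟧ᵢ (regs s j) (regs s k)) s
  exec (loadᵢ i p)     s = setReg i (getIndex p s) s
  exec (storeᵢ p i)    s = setIndex p (regs s i) s
  exec (zeroᵣ p)       s = setReal p 0# s
  exec (oneᵣ p)        s = setReal p 1# s
  exec (moveᵣ p q)     s = setReal p (getReal q s) s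
  exec (opᵣ o p q r)   s = setReal p (⟦ o ⟧ᵣ (getReal q s) (getReal r s)) s

  data Enabled (s : State) : Instr → Set (c L.⊔ ℓ₁) where
    constᵢ : ∀ {i n} → Enabled s (constᵢ i n)
    opᵢ    : ∀ {o i j k} → Enabled s (opᵢ o i j k)
    loadᵢ  : ∀ {i p} → Enabled s (loadᵢ i p)
    storeᵢ : ∀ {p i} → Enabled s (storeᵢ p i)
    zeroᵣ  : ∀ {p} → Enabled s (zeroᵣ p)
    oneᵣ   : ∀ {p} → Enabled s (oneᵣ p)
    moveᵣ  : ∀ {p q} → Enabled s (moveᵣ p q)
    addᵣ   : ∀ {p q r} → Enabled s (opᵣ add p q r)
    subᵣ   : ∀ {p q r} → Enabled s (opᵣ sub p q r)
    mulᵣ   : ∀ {p q r} → Enabled s (opᵣ mul p q r)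
    divᵣ   : ∀ {p q r} → ¬ (getReal r s ≈ 0#) → Enabled s (opᵣ div p q r)

  data Holds (s : State) : Test → Set (c L.⊔ ℓ₂) where
    ≤ᵢ-holds : ∀ {i j} → regs s i ℕ.≤ regs s j → Holds s (i ≤ᵢ j)
    ≤ᵣ-holds : ∀ {p q} → getReal p s ≤ getReal q s → Holds s (p ≤ᵣ q)

  -- p ∶ s ⇓[ t ] s′ : started in s, the program p halts in s′ after t steps.
  -- Every instruction and every evaluation of a test is one step; a division
  -- by zero is stuck.
  infix 4 _∶_⇓[_]_
  data _∶_⇓[_]_ : Prog → State → ℕ → State → Set (c L.⊔ ℓ₁ L.⊔ ℓ₂) where
    skip  : ∀ {s} → skip ∶ s ⇓[ 0 ] s
    instr : ∀ {ι s} → Enabled s ι → instr ι ∶ s ⇓[ 1 ] exec ι s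
    seq   : ∀ {p q s s′ s″ t u} →
            p ∶ s ⇓[ t ] s′ → q ∶ s′ ⇓[ u ] s″ →
            (p ⨾ q) ∶ s ⇓[ t ℕ.+ u ] s″
    then′ : ∀ {b p q s s′ t} →
            Holds s b → p ∶ s ⇓[ t ] s′ →
            (when b then p else q) ∶ s ⇓[ suc t ] s′
    else′ : ∀ {b p q s s′ t} →
            ¬ Holds s b → q ∶ s ⇓[ t ] s′ →
            (when b then p else q) ∶ s ⇓[ suc t ] s′
    stop  : ∀ {b p s} →
            ¬ Holds s b →
            (while b repeat p) ∶ s ⇓[ 1 ] s
    loop  : ∀ {b p s s′ s″ t u} →
            Holds s b → p ∶ s ⇓[ t ] s′ → (while b repeat p) ∶ s′ ⇓[ u ] s″ →
            (while b repeat p) ∶ s ⇓[ suc (t ℕ.+ u) ] s″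

  ----------------------------------------------------------------------
  -- Problems.  `InputAt x s` and `OutputAt y s` say how an instance and a
  -- solution are laid out in memory; they leave all other memory arbitrary,
  -- so programs cannot rely on its initial contents.

  record Problem : Set (L.suc (c L.⊔ ℓ₁ L.⊔ ℓ₂)) where
    field
      Instance     : (size : ℕ) → Set c
      Solution     : (size : ℕ) → Set c
      IsSolutionOf : ∀ {n} → Solution n → Instance n → Set (ℓ₁ L.⊔ ℓ₂)
      InputAt      : ∀ {n} → Instance n → State → Set ℓ₁
      OutputAt     : ∀ {n} → Solution n → State → Set ℓ₁

  SizeIs : ℕ → State → Set
  SizeIs n s = regs s 0 ≡ n

  Stored : ∀ {n} → Arr → Vector Carrier n → State → Set ℓ₁
  Stored a v s = ∀ i → reals s a (toℕ i) ≈ v i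

  IsMax IsMin : {I : Set} → (I → Carrier) → Carrier → Set (ℓ₁ L.⊔ ℓ₂)
  IsMax f m = (∃[ i ] m ≈ f i) × (∀ i → f i ≤ m)
  IsMin f m = (∃[ i ] m ≈ f i) × (∀ i → m ≤ f i)

  -- Starting positions (from 0) of the blocks of length ℓ in a sequence of
  -- length n.
  Start : (n ℓ : ℕ) → Set
  Start n ℓ = ∃[ i ] i ℕ.+ ℓ ℕ.≤ n

  blockSum : ∀ {n} → Vector Carrier n → (ℓ : ℕ) → Start n ℓ → Carrier
  blockSum a ℓ (i , i+ℓ≤n) = sum {ℓ} λ j → a (inject≤ (i ↑ʳ j) i+ℓ≤n)

  -- The entry of m at position l, counted from 0, belongs to length 1 + l.
  MCSP : Problem
  MCSP = record
    { Instance     = Vector Carrier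
    ; Solution     = Vector Carrier
    ; IsSolutionOf = λ m a → ∀ l → IsMax (blockSum a (suc (toℕ l))) (m l)
    ; InputAt      = λ {n} a s → SizeIs n s × Stored 0 a s
    ; OutputAt     = λ {n} m s → SizeIs n s × Stored 0 m s
    }

  -- The pairs (i , k - i) with 0 ≤ i ≤ n and 0 ≤ k - i ≤ n.
  Split : (n k : ℕ) → Set
  Split n k = Σ (Fin (suc n) × Fin (suc n)) λ (i , j) → toℕ i ℕ.+ toℕ j ≡ k

  MinPlusConvolution : Problem
  MinPlusConvolution = record
    { Instance     = λ n → Vector Carrier (suc n) × Vector Carrier (suc n)
    ; Solution     = λ n → Vector Carrier (suc (2 ℕ.* n))
    ; IsSolutionOf = λ {n} z (x , y) →
        ∀ k → IsMin {Split n (toℕ k)} (λ ((i , j) , _) → x i + y j) (z k)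
    ; InputAt      = λ {n} (x , y) s → SizeIs n s × Stored 0 x s × Stored 1 y s
    ; OutputAt     = λ {n} z s → SizeIs n s × Stored 0 z s
    }

  open Problem

  -- `transform` and `recover` are single programs working for all sizes.
  -- The bound O(n) is written constant * (1 + n) because size 0 is allowed.
  -- `recover` has access to the solution of the transformed instance only:
  -- it must work from every memory in which that solution is stored.
  record LinearReduction (P Q : Problem) : Set (c L.⊔ ℓ₁ L.⊔ ℓ₂) where
    field
      constant  : ℕ
      transform : Prog
      recover   : Prog
      correct   :
        ∀ {n} (x : Instance P n) s → InputAt P x s →
        ∃[ m ] Σ (Instance Q m) λ y → ∃[ t ] ∃[ s′ ]
          m ℕ.≤ constant ℕ.* suc n ×
          (transform ∶ s ⇓[ t ] s′) ×
          t ℕ.≤ constant ℕ.* suc n ×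
          InputAt Q y s′ ×
          (∀ (z : Solution Q m) → IsSolutionOf Q z y →
           ∀ r → OutputAt Q z r →
           Σ (Solution P n) λ w → ∃[ u ] ∃[ r′ ]
             (recover ∶ r ⇓[ u ] r′) ×
             u ℕ.≤ constant ℕ.* suc n ×
             OutputAt P w r′ ×
             IsSolutionOf P w x)

  SolvableIn : Problem → (ℕ → ℕ) → Set (c L.⊔ ℓ₁ L.⊔ ℓ₂)
  SolvableIn P T =
    Σ Prog λ p → ∀ {n} (x : Instance P n) s → InputAt P x s →
      ∃[ t ] ∃[ s′ ] Σ (Solution P n) λ w →
        (p ∶ s ⇓[ t ] s′) × t ℕ.≤ T n × OutputAt P w s′ × IsSolutionOf P w x

  -- Up to linear terms, P is no harder than Q: a time bound T for Q gives the
  -- time bound  max { T m ∣ m ≤ C (1 + n) } + C (1 + n)  for P, with C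
  -- independent of T.
  infix 4 _≲_
  _≲_ : Problem → Problem → Set (c L.⊔ ℓ₁ L.⊔ ℓ₂)
  P ≲ Q =
    ∃[ C ] ∀ T → SolvableIn Q T →
      SolvableIn P (λ n → maxUpTo T (C ℕ.* suc n) ℕ.+ C ℕ.* suc n)

{-# OPTIONS --safe #-}

-- The sum of a block a_{p+1} + … + a_{p+ℓ} is Q (p + ℓ) - Q p for any Q with
-- differences a, so MCSP is the (max,+)-correlation of such a sequence with
-- itself.  With the prefix sums S and x_i = - S_i, y_j = S_{n-j}, the
-- convolution at n + ℓ is - m_ℓ.  Conversely, let Q run through
-- x_n, …, x_0, M - y_0, …, M - y_n, x_n - M.  If M is large, the best block of
-- length k + 1 joins some x_i to some M - y_j with i + j = k, so its sum is
-- M - z_k.  Recovery does not know M, but the last point makes the sum of the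
-- whole sequence equal to - M.
module Submission where

import Algebra.Properties.AbelianGroup as AbelianGroupProperties
import Algebra.Properties.CommutativeMonoid.Sum as Sum
import Algebra.Solver.CommutativeMonoid as CommutativeMonoidSolver
open import Data.Empty using (⊥-elim)
open import Data.Empty.Polymorphic using (⊥)
open import Data.Fin.Base using (Fin; zero; suc; toℕ; fromℕ<; inject≤; _↑ʳ_)
open import Data.Fin.Properties
  using (toℕ-fromℕ<; toℕ-inject≤; toℕ-↑ʳ; toℕ<n; toℕ≤pred[n])
open import Data.List.Base using (List; []; _∷_; length)
open import Data.Nat as ℕ using (ℕ; zero; suc; z≤n; s≤s; _∸_)
import Data.Nat.Properties as ℕₚ
open import Data.Nat.Tactic.RingSolver using (solve-∀)
open import Data.Product using (_×_; _,_; proj₁; proj₂; ∃-syntax; Σ)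
open import Data.Sum using (_⊎_; inj₁; inj₂)
open import Data.Unit.Polymorphic using (⊤)
open import Data.Vec.Functional using (Vector)
open import Defs
open import Function using (_∘_; case_of_)
import Level as L
open import Relation.Binary.Bundles using (Poset)
open import Relation.Binary.PropositionalEquality
  using (_≡_; _≢_; refl; sym; trans; cong; cong₂; subst; subst₂)
import Relation.Binary.Reasoning.PartialOrder as PartialOrderReasoning
open import Relation.Binary.Structures using (module IsDecTotalOrder)
open import Relation.Nullary using (¬_; yes; no; contradiction)
open import Relation.Nullary.Decidable using (dec-true; dec-false)

-- "Large" means M = 4B, where `B` bounds all |x_i| and |y_j| and is found by comparisons. Two
-- points of the same half of `Q` differ by at most 2B, and a block that ends at the last point has
-- a sum lower by a further M or 2M. A block from x_i to M - y_j has sum M - (x_i + y_j) ≥ M - 2B =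
-- 2B, so no other block exceeds it. Ties are possible: the maximum may be attained by a block that
-- stays in one half. Its value is then also the value of a crossing block of the same length, and
-- only values enter the convolution. Machine and arithmetic are kept apart. Program invariants
-- describe the contents of cells by propositional equalities with expressions in the initial
-- memory, read as functions on all of ℕ; `≈` enters only where memory is compared with an instance
-- or a solution.

update-at : ∀ {a} {A : Set a} (f : ℕ → A) {i j} x → i ≡ j → (f [ i ↦ x ]) j ≡ x
update-at f {i} {j} x i≡j rewrite dec-true (i ℕ.≟ j) i≡j = refl

-- The written index appears in a state as a register expression `h`, while the disequality is known
-- for its value `i`; hence the two names.
update-off : ∀ {a} {A : Set a} (f : ℕ → A) {h i j} x → h ≡ i → i ≢ j → (f [ h ↦ x ]) j ≡ f j
update-off f {i = i} {j} x refl i≢j rewrite dec-false (i ℕ.≟ j) i≢j = refl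

block : List Instr → Prog
block []       = skip
block (ι ∷ ιs) = instr ι ⨾ block ιs

maxUpTo-upper : ∀ T {m} k → m ℕ.≤ k → T m ℕ.≤ maxUpTo T k
maxUpTo-upper T zero    z≤n = ℕₚ.≤-refl
maxUpTo-upper T (suc k) m≤1+k with ℕₚ.m≤n⇒m<n∨m≡n m≤1+k
... | inj₁ (s≤s m≤k) = ℕₚ.≤-trans (maxUpTo-upper T k m≤k) (ℕₚ.m≤m⊔n _ _)
... | inj₂ refl      = ℕₚ.m≤n⊔m (maxUpTo T k) _

m+n≡o⇒m≤o : ∀ {m n o} → m ℕ.+ n ≡ o → m ℕ.≤ o
m+n≡o⇒m≤o {m} {n} m+n≡o = subst (m ℕ.≤_) m+n≡o (ℕₚ.m≤m+n m n)

m+n≡o⇒n≤o : ∀ {m n o} → m ℕ.+ n ≡ o → n ℕ.≤ o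
m+n≡o⇒n≤o {m} {n} m+n≡o = subst (n ℕ.≤_) m+n≡o (ℕₚ.m≤n+m n m)

-- Ordered-field arithmetic, telescoping sums and absolute bounds.

module OrderedFieldProperties {c ℓ₁ ℓ₂} (R : OrderedField c ℓ₁ ℓ₂) where

  open OrderedField R public
    using (Carrier; _≈_; _≤_; _+_; _-_; -_; 0#; isDecTotalOrder; +-monoˡ-≤;
           +-commutativeMonoid; +-abelianGroup; +-comm; +-assoc; +-cong; +-congˡ; +-congʳ;
           +-identityˡ; +-identityʳ; -‿inverseˡ; -‿inverseʳ)
    renaming (refl to ≈-refl; sym to ≈-sym; trans to ≈-trans; reflexive to ≈-reflexive)
  open Sum +-commutativeMonoid public using (sum)
  open AbelianGroupProperties +-abelianGroup public
    using () renaming (∙-cancelʳ to +-cancelʳ; inverseˡ-unique to -‿uniqueˡ)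
  open CommutativeMonoidSolver +-commutativeMonoid using (solve; _⊕_; _⊜_)

  poset : Poset c ℓ₁ ℓ₂
  poset = record { isPartialOrder = isPartialOrder }
    where open IsDecTotalOrder isDecTotalOrder

  open Poset poset public
    using (≤-respˡ-≈; ≤-respʳ-≈)
    renaming (refl to ≤-refl; trans to ≤-trans; reflexive to ≤-reflexive; antisym to ≤-antisym)
  module ≤-Reasoning = PartialOrderReasoning poset
  open ≤-Reasoning

  open IsDecTotalOrder isDecTotalOrder public using (_≤?_; total)

  ≰⇒≥ : ∀ {x y} → ¬ (x ≤ y) → y ≤ x
  ≰⇒≥ {x} {y} x≰y with total x y
  ... | inj₁ x≤y = contradiction x≤y x≰y
  ... | inj₂ y≤x = y≤x

  +-monoʳ-≤ : ∀ z {x y} → x ≤ y → z + x ≤ z + y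
  +-monoʳ-≤ z {x} {y} x≤y = begin
    z + x  ≈⟨ +-comm z x ⟩
    x + z  ≤⟨ +-monoˡ-≤ z x≤y ⟩
    y + z  ≈⟨ +-comm y z ⟩
    z + y  ∎

  +-mono-≤ : ∀ {x y u v} → x ≤ y → u ≤ v → x + u ≤ y + v
  +-mono-≤ {y = y} {u = u} x≤y u≤v = ≤-trans (+-monoˡ-≤ u x≤y) (+-monoʳ-≤ y u≤v)

  x+z-z≈x : ∀ x z → (x + z) - z ≈ x
  x+z-z≈x x z = ≈-trans (+-assoc x z (- z)) (≈-trans (+-congˡ (-‿inverseʳ z)) (+-identityʳ x))

  x-z+z≈x : ∀ x z → (x - z) + z ≈ x
  x-z+z≈x x z = ≈-trans (+-assoc x (- z) z) (≈-trans (+-congˡ (-‿inverseˡ z)) (+-identityʳ x))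

  +-cancelʳ-≤ : ∀ z {x y} → x + z ≤ y + z → x ≤ y
  +-cancelʳ-≤ z {x} {y} x+z≤y+z = begin
    x            ≈⟨ x+z-z≈x x z ⟨
    (x + z) - z  ≤⟨ +-monoˡ-≤ (- z) x+z≤y+z ⟩
    (y + z) - z  ≈⟨ x+z-z≈x y z ⟩
    y            ∎

  x≤x+y : ∀ x {y} → 0# ≤ y → x ≤ x + y
  x≤x+y x {y} 0≤y = begin
    x       ≈⟨ +-identityʳ x ⟨
    x + 0#  ≤⟨ +-monoʳ-≤ x 0≤y ⟩
    x + y   ∎

  0≤x+y : ∀ {x y} → 0# ≤ x → 0# ≤ y → 0# ≤ x + y
  0≤x+y {x} 0≤x 0≤y = ≤-trans 0≤x (x≤x+y x 0≤y)

  -- Differences are expressed by addition on the left, so that rearrangements are within reach of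
  -- the commutative monoid solver.
  sum-telescopes : ∀ {ℓ} (f : Vector Carrier ℓ) (Q : ℕ → Carrier) →
                   (∀ j → f j + Q (toℕ j) ≈ Q (suc (toℕ j))) → sum f + Q 0 ≈ Q ℓ
  sum-telescopes {zero}  f Q step = +-identityˡ (Q 0)
  sum-telescopes {suc ℓ} f Q step = begin-equality
    (f zero + sum (f ∘ suc)) + Q 0  ≈⟨ solve 3 (λ a b q → (a ⊕ b) ⊕ q ⊜ b ⊕ (a ⊕ q)) ≈-refl _ _ _ ⟩
    sum (f ∘ suc) + (f zero + Q 0)  ≈⟨ +-congˡ (step zero) ⟩
    sum (f ∘ suc) + Q 1             ≈⟨ sum-telescopes (f ∘ suc) (Q ∘ suc) (step ∘ suc) ⟩
    Q (suc ℓ)                       ∎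

  -- This is |x| ≤ B. The negative is written `0# - x` because that is what the machine computes,
  -- subtracting from a cell that holds zero.
  IsBoundFor : Carrier → Carrier → Set ℓ₂
  IsBoundFor B x = (x ≤ B) × (0# - x ≤ B)

  bound-mono : ∀ {B C x} → B ≤ C → IsBoundFor B x → IsBoundFor C x
  bound-mono B≤C (x≤B , -x≤B) = ≤-trans x≤B B≤C , ≤-trans -x≤B B≤C

  -- Here `b` is the sum of a block whose two end points lie in the same half of the arranged
  -- sequence.
  difference-≤ : ∀ {B b x y} → IsBoundFor B x → IsBoundFor B y → b + x ≈ y → b ≤ B + B
  difference-≤ {B} {b} {x} {y} (_ , -x≤B) (y≤B , _) b+x≈y = begin
    b                   ≈⟨ x+z-z≈x b x ⟨
    (b + x) - x         ≈⟨ +-congˡ (+-identityˡ (- x)) ⟨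
    (b + x) + (0# - x)  ≈⟨ +-congʳ b+x≈y ⟩
    y + (0# - x)        ≤⟨ +-mono-≤ y≤B -x≤B ⟩
    B + B               ∎

-- A program logic with exact step counts.

module Machine {c ℓ₁ ℓ₂} (R : OrderedField c ℓ₁ ℓ₂) where

  open OrderedFieldProperties R
  open RealRAM R
  open State

  -- A total-correctness triple for one initial state. The step count is a parameter and not part of
  -- the existential, so the times of loop bodies are uniform and those of loops are closed
  -- expressions.
  Runs : ∀ {ℓ} → Prog → State → ℕ → (State → Set ℓ) → Set (c L.⊔ ℓ₁ L.⊔ ℓ₂ L.⊔ ℓ)
  Runs p s t Q = ∃[ s′ ] (p ∶ s ⇓[ t ] s′) × Q s′

  infixr 4 _>>=_
  _>>=_ : ∀ {ℓ ℓ′} {Q : State → Set ℓ} {Q′ : State → Set ℓ′} {p q s t u} →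
          Runs p s t Q → (∀ {s′} → Q s′ → Runs q s′ u Q′) → Runs (p ⨾ q) s (t ℕ.+ u) Q′
  (s′ , p⇓ , Qs′) >>= run with run Qs′
  ... | s″ , q⇓ , Q′s″ = s″ , seq p⇓ q⇓ , Q′s″

  runs-map : ∀ {ℓ ℓ′} {Q : State → Set ℓ} {Q′ : State → Set ℓ′} {p s t} →
             Runs p s t Q → (∀ {s′} → Q s′ → Q′ s′) → Runs p s t Q′
  runs-map (s′ , p⇓ , Qs′) Q⇒Q′ = s′ , p⇓ , Q⇒Q′ Qs′

  -- Division is the only instruction whose execution has a side condition. On a concrete block this
  -- reduces to the unit type, so the implicit arguments of this type are filled in by eta.
  Division-free : List Instr → Set
  Division-free []                    = ⊤
  Division-free (opᵣ div _ _ _ ∷ ιs)  = ⊥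
  Division-free (_ ∷ ιs)              = Division-free ιs

  -- On a concrete block this computes to an explicit state, with updates of differently named
  -- registers and arrays resolved; many invariant fields are therefore carried over as they are or
  -- hold by `refl`.
  execs : List Instr → State → State
  execs []       s = s
  execs (ι ∷ ιs) s = execs ιs (exec ι s)

  block-⇓ : ∀ ιs {_ : Division-free ιs} {s} → block ιs ∶ s ⇓[ length ιs ] execs ιs s
  block-⇓ []                        = skip
  block-⇓ (constᵢ _ _ ∷ ιs)    {df} = seq (instr constᵢ) (block-⇓ ιs {df})
  block-⇓ (opᵢ _ _ _ _ ∷ ιs)   {df} = seq (instr opᵢ) (block-⇓ ιs {df})
  block-⇓ (loadᵢ _ _ ∷ ιs)     {df} = seq (instr loadᵢ) (block-⇓ ιs {df})
  block-⇓ (storeᵢ _ _ ∷ ιs)    {df} = seq (instr storeᵢ) (block-⇓ ιs {df})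
  block-⇓ (zeroᵣ _ ∷ ιs)       {df} = seq (instr zeroᵣ) (block-⇓ ιs {df})
  block-⇓ (oneᵣ _ ∷ ιs)        {df} = seq (instr oneᵣ) (block-⇓ ιs {df})
  block-⇓ (moveᵣ _ _ ∷ ιs)     {df} = seq (instr moveᵣ) (block-⇓ ιs {df})
  block-⇓ (opᵣ add _ _ _ ∷ ιs) {df} = seq (instr addᵣ) (block-⇓ ιs {df})
  block-⇓ (opᵣ sub _ _ _ ∷ ιs) {df} = seq (instr subᵣ) (block-⇓ ιs {df})
  block-⇓ (opᵣ mul _ _ _ ∷ ιs) {df} = seq (instr mulᵣ) (block-⇓ ιs {df})

  block-runs : ∀ ιs {_ : Division-free ιs} {ℓ} {Q : State → Set ℓ} {s} →
               Q (execs ιs s) → Runs (block ιs) s (length ιs) Q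
  block-runs ιs {df} Qs′ = _ , block-⇓ ιs {df} , Qs′

  block-executes : ∀ ιs {_ : Division-free ιs} {s} → Runs (block ιs) s (length ιs) (_≡ execs ιs s)
  block-executes ιs {df} = block-runs ιs {df} refl

  -- The index of the invariant is the exact number of remaining iterations and decides the test.
  -- Each iteration costs its body and one test; the final 1 is the failing test.
  while-runs : ∀ {ℓ} (I : ℕ → State → Set ℓ) {b p t} →
               (∀ {k s} → I (suc k) s → Holds s b × Runs p s t (I k)) →
               (∀ {s} → I 0 s → ¬ Holds s b) →
               ∀ k {s} → I k s → Runs (while b repeat p) s (k ℕ.* suc t ℕ.+ 1) (I 0)
  while-runs I step done zero    {s} Is = s , stop (done Is) , Is
  while-runs I {b} {p} {t} step done (suc k) {s} Is with step Is
  ... | holds , s′ , p⇓ , Is′ with while-runs I step done k Is′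
  ... | s″ , while⇓ , Is″ =
    s″ ,
    subst (λ u → (while b repeat p) ∶ s ⇓[ suc u ] s″) (sym (ℕₚ.+-assoc t _ 1)) (loop holds p⇓ while⇓) ,
    Is″

  -- In all programs register 0 holds the size, register 1 the number 1 and
  -- register 2 the number of remaining iterations; cells indexed by register 1
  -- serve as real variables.
  record Counting (k : ℕ) (s : State) : Set where
    constructor counting
    field
      one       : regs s 1 ≡ 1
      remaining : regs s 2 ≡ k

  countdown : Prog → Prog
  countdown p = while (1 ≤ᵢ 2) repeat p

  countdown-runs : ∀ {ℓ} (I : ℕ → State → Set ℓ) {p t} →
                   (∀ {k s} → I k s → Counting k s) →
                   (∀ {k s} → I (suc k) s → Runs p s t (I k)) →
                   ∀ k {s} → I k s → Runs (countdown p) s (k ℕ.* suc t ℕ.+ 1) (I 0)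
  countdown-runs I counter step = while-runs I
    (λ Is → holds (counter Is) , step Is)
    (λ Is → fails (counter Is))
    where
    holds : ∀ {k s} → Counting (suc k) s → Holds s (1 ≤ᵢ 2)
    holds (counting one remaining) = ≤ᵢ-holds (subst₂ ℕ._≤_ (sym one) (sym remaining) (s≤s z≤n))
    fails : ∀ {s} → Counting 0 s → ¬ Holds s (1 ≤ᵢ 2)
    fails (counting one remaining) (≤ᵢ-holds 1≤0) with () ← subst₂ ℕ._≤_ one remaining 1≤0

  -- Programs reducing MCSP to convolution.

  module MCSP-to-Convolution where

    prefixSum : (ℕ → Carrier) → ℕ → Carrier
    prefixSum α zero    = 0#
    prefixSum α (suc i) = prefixSum α i + α i

    initialise scan finish : List Instr
    initialise = constᵢ 1 1 ∷ constᵢ 3 0 ∷ opᵢ add 2 3 0 ∷ zeroᵣ (2 [ 1 ]) ∷ zeroᵣ (4 [ 1 ]) ∷ []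
    -- There are n + 1 prefix sums but only n inputs: the last one is written out without reading
    -- another entry.
    finish     = opᵣ sub (0 [ 3 ]) (4 [ 1 ]) (2 [ 1 ]) ∷ moveᵣ (1 [ 2 ]) (2 [ 1 ]) ∷ []
    -- The input entry is saved before its cell is overwritten by the negated prefix sum.
    scan       = moveᵣ (3 [ 1 ]) (0 [ 3 ]) ∷
                 opᵣ sub (0 [ 3 ]) (4 [ 1 ]) (2 [ 1 ]) ∷ moveᵣ (1 [ 2 ]) (2 [ 1 ]) ∷
                 opᵣ add (2 [ 1 ]) (2 [ 1 ]) (3 [ 1 ]) ∷
                 opᵢ monus 2 2 1 ∷ opᵢ add 3 1 3 ∷ []

    transform : Prog
    transform = block initialise ⨾ countdown (block scan) ⨾ block finish

    -- Array 0 is transformed in place: cells below `i` are output, the others are still input.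
    -- Register 2 has two roles, since the number `k` of remaining iterations is also the reflected
    -- position n - i at which array 1 is written.
    record Scanned (n : ℕ) (α : ℕ → Carrier) (k : ℕ) (s : State) : Set c where
      field
        {i}         : ℕ
        i+k≡n       : i ℕ.+ k ≡ n
        size        : regs s 0 ≡ n
        counter     : Counting k s
        position    : regs s 3 ≡ i
        accumulator : getReal (2 [ 1 ]) s ≡ prefixSum α i
        null        : getReal (4 [ 1 ]) s ≡ 0#
        unread      : ∀ j → i ℕ.≤ j → reals s 0 j ≡ α j
        negated     : ∀ j → j ℕ.< i → reals s 0 j ≡ 0# - prefixSum α j
        reflected   : ∀ j j′ → j ℕ.+ j′ ≡ n → j ℕ.< i → reals s 1 j′ ≡ prefixSum α j

    record Transformed (n : ℕ) (α : ℕ → Carrier) (s : State) : Set c where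
      field
        size      : regs s 0 ≡ n
        negated   : ∀ j → j ℕ.≤ n → reals s 0 j ≡ 0# - prefixSum α j
        reflected : ∀ j j′ → j ℕ.+ j′ ≡ n → reals s 1 j′ ≡ prefixSum α j

    module _ {n : ℕ} {α : ℕ → Carrier} where

      -- The loop body and `finish` make the same writes to arrays 0 and 1, so this lemma and
      -- `reflected′` serve both.
      negated′ : ∀ {k s} (inv : Scanned n α k s) → let open Scanned inv in ∀ j → j ℕ.< suc i →
                 (reals s 0 [ regs s 3 ↦ getReal (4 [ 1 ]) s - getReal (2 [ 1 ]) s ]) j ≡ 0# - prefixSum α j
      negated′ {s = s} inv j j<1+i with ℕₚ.m<1+n⇒m<n∨m≡n j<1+i
        where open Scanned inv
      ... | inj₂ refl = trans (update-at (reals s 0) _ position) (cong₂ _-_ null accumulator)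
        where open Scanned inv
      ... | inj₁ j<i  = trans (update-off (reals s 0) _ position (ℕₚ.>⇒≢ j<i)) (negated j j<i)
        where open Scanned inv

      reflected′ : ∀ {k s} (inv : Scanned n α k s) → let open Scanned inv in
                   ∀ j j′ → j ℕ.+ j′ ≡ n → j ℕ.< suc i →
                   (reals s 1 [ regs s 2 ↦ getReal (2 [ 1 ]) s ]) j′ ≡ prefixSum α j
      reflected′ {k} {s} inv j j′ j+j′≡n j<1+i with ℕₚ.m<1+n⇒m<n∨m≡n j<1+i
        where open Scanned inv
      ... | inj₂ refl = trans
        (update-at (reals s 1) _ (trans remaining (ℕₚ.+-cancelˡ-≡ j k j′ (trans i+k≡n (sym j+j′≡n)))))
        accumulator
        where open Scanned inv
              open Counting counter
      ... | inj₁ j<i  = trans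
        (update-off (reals s 1) _ remaining λ { refl →
          ℕₚ.<⇒≢ j<i (ℕₚ.+-cancelʳ-≡ k j i (trans j+j′≡n (sym i+k≡n))) })
        (reflected j j′ j+j′≡n j<i)
        where open Scanned inv
              open Counting counter

      scan-preserves : ∀ {k s} → Scanned n α (suc k) s → Scanned n α k (execs scan s)
      scan-preserves {k} {s} inv = record
        { i           = suc i
        ; i+k≡n       = trans (sym (ℕₚ.+-suc i k)) i+k≡n
        ; size        = size
        ; counter     = counting one (cong₂ _∸_ remaining one)
        ; position    = cong₂ ℕ._+_ one position
        ; accumulator = trans (update-at (reals s 2) _ refl)
                        (cong₂ _+_ accumulator (trans (update-at (reals s 3) _ refl)
                          (trans (unread _ (ℕₚ.≤-reflexive (sym position))) (cong α position))))
        ; null        = null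
        ; unread      = λ j i<j → trans (update-off (reals s 0) _ position (ℕₚ.<⇒≢ i<j)) (unread j (ℕₚ.<⇒≤ i<j))
        ; negated     = negated′ inv
        ; reflected   = reflected′ inv
        }
        where
        open Scanned inv
        open Counting counter

      finish-transforms : ∀ {s} → Scanned n α 0 s → Transformed n α (execs finish s)
      finish-transforms {s} inv = record
        { size      = size
        ; negated   = λ j j≤n → negated′ inv j (s≤s (subst (j ℕ.≤_) n≡i j≤n))
        ; reflected = λ j j′ j+j′≡n → reflected′ inv j j′ j+j′≡n (s≤s (m+n≡o⇒m≤o (trans j+j′≡n n≡i)))
        }
        where
        open Scanned inv
        n≡i = trans (sym i+k≡n) (ℕₚ.+-identityʳ i)

    transform-runs : ∀ {n s} → regs s 0 ≡ n →
                     Runs transform s (5 ℕ.+ ((n ℕ.* 7 ℕ.+ 1) ℕ.+ 2)) (Transformed n (reals s 0))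
    transform-runs {n} {s} size =
      block-runs initialise initialised >>= λ inv →
      countdown-runs (Scanned n (reals s 0)) Scanned.counter
        (block-runs scan ∘ scan-preserves) n inv >>= λ inv →
      block-runs finish (finish-transforms inv)
      where
      initialised : Scanned n (reals s 0) n (execs initialise s)
      initialised = record
        { i = 0
        ; i+k≡n = refl
        ; size = size
        ; counter = counting refl size
        ; position = refl
        ; accumulator = refl
        ; null = refl
        ; unread = λ j _ → refl
        ; negated = λ j ()
        ; reflected = λ j j′ _ ()
        }

    prepare shift : List Instr
    prepare = constᵢ 1 1 ∷ constᵢ 3 0 ∷ opᵢ add 2 3 0 ∷ opᵢ add 3 1 0 ∷ zeroᵣ (1 [ 1 ]) ∷ []
    shift   = opᵢ monus 2 2 1 ∷ opᵢ add 4 3 2 ∷ opᵣ sub (0 [ 2 ]) (1 [ 1 ]) (0 [ 4 ]) ∷ []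

    recover : Prog
    recover = block prepare ⨾ countdown (block shift)

    -- Working in place is safe because reads go to cells above n and writes to cells below n. The
    -- source offset is n + 1 because position j belongs to block length j + 1.
    record Shifted (n : ℕ) (ζ : ℕ → Carrier) (k : ℕ) (s : State) : Set c where
      field
        k≤n       : k ℕ.≤ n
        size      : regs s 0 ≡ n
        counter   : Counting k s
        base      : regs s 3 ≡ suc n
        null      : getReal (1 [ 1 ]) s ≡ 0#
        unread    : ∀ j → n ℕ.< j → reals s 0 j ≡ ζ j
        recovered : ∀ j → k ℕ.≤ j → j ℕ.< n → reals s 0 j ≡ 0# - ζ (suc n ℕ.+ j)

    shift-preserves : ∀ {n ζ k s} → Shifted n ζ (suc k) s → Shifted n ζ k (execs shift s)
    shift-preserves {n} {ζ} {k} {s} inv = record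
      { k≤n       = ℕₚ.<⇒≤ k≤n
      ; size      = size
      ; counter   = counting one remaining′
      ; base      = base
      ; null      = null
      ; unread    = λ j n<j → trans (update-off (reals s 0) _ remaining′ (ℕₚ.<⇒≢ (ℕₚ.<-trans k≤n n<j)))
                                  (unread j n<j)
      ; recovered = recovered′
      }
      where
      open Shifted inv
      open Counting counter
      remaining′ : regs s 2 ∸ regs s 1 ≡ k
      remaining′ = cong₂ _∸_ remaining one
      source : regs s 3 ℕ.+ (regs s 2 ∸ regs s 1) ≡ suc n ℕ.+ k
      source = cong₂ ℕ._+_ base remaining′
      recovered′ : ∀ j → k ℕ.≤ j → j ℕ.< n → reals (execs shift s) 0 j ≡ 0# - ζ (suc n ℕ.+ j)
      recovered′ j k≤j j<n with ℕₚ.m≤n⇒m<n∨m≡n k≤j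
      ... | inj₁ k<j  = trans (update-off (reals s 0) _ remaining′ (ℕₚ.<⇒≢ k<j)) (recovered j k<j j<n)
      ... | inj₂ refl = trans (update-at (reals s 0) _ remaining′)
        (cong₂ _-_ null (trans (cong (reals s 0) source) (unread _ (s≤s (ℕₚ.m≤m+n n k)))))

    recover-runs : ∀ {n s} → regs s 0 ≡ n →
                   Runs recover s (5 ℕ.+ (n ℕ.* 4 ℕ.+ 1)) (Shifted n (reals s 0) 0)
    recover-runs {n} {s} size =
      block-runs prepare prepared >>=
      countdown-runs (Shifted n (reals s 0)) Shifted.counter (block-runs shift ∘ shift-preserves) n
      where
      prepared : Shifted n (reals s 0) n (execs prepare s)
      prepared = record
        { k≤n       = ℕₚ.≤-refl
        ; size      = size
        ; counter   = counting refl size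
        ; base      = cong suc size
        ; null      = refl
        ; unread    = λ j _ → refl
        ; recovered = λ j n≤j j<n → ⊥-elim (ℕₚ.<⇒≱ j<n n≤j)
        }

  -- Programs reducing convolution to MCSP.

  module Convolution-to-MCSP where

    -- The idle move in the second branch lets both branches end in a state of the
    -- same form, after the same number of steps.
    raise raiseToAbs : Cell → Prog
    raise p      = when (3 [ 1 ]) ≤ᵣ p then instr (moveᵣ (3 [ 1 ]) p) else instr (moveᵣ (3 [ 1 ]) (3 [ 1 ]))
    raiseToAbs p = raise p ⨾ block (opᵣ sub (5 [ 1 ]) (4 [ 1 ]) p ∷ []) ⨾ raise (5 [ 1 ])

    raise-runs : ∀ p {ℓ} {Q : State → Set ℓ} {s} →
                 (∀ b → getReal (3 [ 1 ]) s ≤ b → getReal p s ≤ b → Q (setReal (3 [ 1 ]) b s)) →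
                 Runs (raise p) s 2 Q
    raise-runs p {s = s} Qb with getReal (3 [ 1 ]) s ≤? getReal p s
    ... | yes B≤x = _ , then′ (≤ᵣ-holds B≤x) (instr moveᵣ) , Qb _ B≤x ≤-refl
    ... | no  B≰x = _ , else′ (λ { (≤ᵣ-holds B≤x) → B≰x B≤x }) (instr moveᵣ) , Qb _ ≤-refl (≰⇒≥ B≰x)

    record Raised (p : Cell) (s s′ : State) : Set (c L.⊔ ℓ₂) where
      field
        regs-kept    : regs s′ ≡ regs s
        array₀-kept  : reals s′ 0 ≡ reals s 0
        array₁-kept  : reals s′ 1 ≡ reals s 1
        array₄-kept  : reals s′ 4 ≡ reals s 4
        grows        : getReal (3 [ 1 ]) s ≤ getReal (3 [ 1 ]) s′
        bounds       : IsBoundFor (getReal (3 [ 1 ]) s′) (getReal p s)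

    -- The cell `p` is read a second time, to form its negative, after the bound may have changed;
    -- the last hypothesis says that this change does not affect it.
    raiseToAbs-runs : ∀ p {s} → getReal (4 [ 1 ]) s ≡ 0# →
                      (∀ b → getReal p (setReal (3 [ 1 ]) b s) ≡ getReal p s) →
                      Runs (raiseToAbs p) s 5 (Raised p s)
    raiseToAbs-runs p {s} null p-kept =
      raise-runs p {Q = λ s₁ → ∃[ b ] s₁ ≡ setReal (3 [ 1 ]) b s × B ≤ b × getReal p s ≤ b}
        (λ b B≤b x≤b → b , refl , B≤b , x≤b) >>= λ { (b , refl , B≤b , x≤b) →
      block-executes (opᵣ sub (5 [ 1 ]) (4 [ 1 ]) p ∷ []) >>= λ { refl →
      raise-runs (5 [ 1 ]) λ b′ b≤b′ -x≤b′ →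
        let b≡  = update-at (reals s 3) {regs s 1} b refl
            b′≡ = update-at (reals s 3 [ regs s 1 ↦ b ]) {regs s 1} b′ refl
            -x≡ = trans (update-at (reals s 5) {regs s 1} _ refl) (cong₂ _-_ null (p-kept b))
            b≤  = subst₂ _≤_ b≡ (sym b′≡) b≤b′
        in record
        { regs-kept   = refl
        ; array₀-kept = refl
        ; array₁-kept = refl
        ; array₄-kept = refl
        ; grows       = ≤-trans B≤b b≤
        ; bounds      = ≤-trans x≤b b≤ , subst₂ _≤_ -x≡ (sym b′≡) -x≤b′
        } } }
      where B = getReal (3 [ 1 ]) s

    initialise₁ initialise₂ initialise₃ arrange differentiate : List Instr
    initialise₁   = constᵢ 1 1 ∷ opᵢ add 2 1 0 ∷ zeroᵣ (3 [ 1 ]) ∷ zeroᵣ (4 [ 1 ]) ∷ []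
    -- Two doublings turn the bound B into M = 4B.
    initialise₂   = opᵣ add (3 [ 1 ]) (3 [ 1 ]) (3 [ 1 ]) ∷ opᵣ add (3 [ 1 ]) (3 [ 1 ]) (3 [ 1 ]) ∷
                    constᵢ 4 0 ∷ opᵢ add 3 1 0 ∷ opᵢ add 2 1 0 ∷ []
    -- Register 2 runs down while register 4 runs up, which reverses x; y keeps its order, being
    -- written at n + 1 plus its own index.
    arrange       = opᵢ monus 2 2 1 ∷ opᵢ add 5 3 2 ∷
                    moveᵣ (2 [ 4 ]) (0 [ 2 ]) ∷ opᵣ sub (2 [ 5 ]) (3 [ 1 ]) (1 [ 2 ]) ∷
                    opᵢ add 4 1 4 ∷ []
    -- Register 0 still holds n here, so `0 [ 0 ]` is x_n; only afterwards does it receive the new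
    -- size 2n + 2.
    initialise₃   = opᵢ add 5 3 3 ∷ opᵣ sub (2 [ 5 ]) (0 [ 0 ]) (3 [ 1 ]) ∷
                    opᵢ add 0 3 3 ∷ opᵢ add 2 3 3 ∷ []
    differentiate = opᵢ monus 2 2 1 ∷ opᵢ add 5 1 2 ∷ opᵣ sub (0 [ 2 ]) (2 [ 5 ]) (2 [ 2 ]) ∷ []

    raiseBound : Prog
    raiseBound = block (opᵢ monus 2 2 1 ∷ []) ⨾ raiseToAbs (0 [ 2 ]) ⨾ raiseToAbs (1 [ 2 ])

    transform : Prog
    transform = block initialise₁ ⨾ countdown raiseBound ⨾
                block initialise₂ ⨾ countdown (block arrange) ⨾
                block initialise₃ ⨾ countdown (block differentiate)

    record Points (n : ℕ) (ξ η : ℕ → Carrier) (M : Carrier) (Q : ℕ → Carrier) : Set c where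
      field
        front : ∀ p q → p ℕ.+ q ≡ n → Q p ≡ ξ q
        back  : ∀ q → q ℕ.≤ n → Q (suc n ℕ.+ q) ≡ M - η q
        final : Q (suc n ℕ.+ suc n) ≡ ξ n - M

    record BoundFor (n : ℕ) (ξ η : ℕ → Carrier) (k : ℕ) (B : Carrier) : Set ℓ₂ where
      field
        nonNegative : 0# ≤ B
        bounds      : ∀ j → k ℕ.≤ j → j ℕ.≤ n → IsBoundFor B (ξ j) × IsBoundFor B (η j)

    record Inputs (n : ℕ) (ξ η : ℕ → Carrier) (k : ℕ) (s : State) : Set c where
      field
        size    : regs s 0 ≡ n
        counter : Counting k s
        array₀  : reals s 0 ≡ ξ
        array₁  : reals s 1 ≡ η

    record Bounded (n : ℕ) (ξ η : ℕ → Carrier) (k : ℕ) (s : State) : Set (c L.⊔ ℓ₂) where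
      field
        inputs : Inputs n ξ η k s
        null   : getReal (4 [ 1 ]) s ≡ 0#
        bound  : BoundFor n ξ η k (getReal (3 [ 1 ]) s)

    record Arranged (n : ℕ) (ξ η : ℕ → Carrier) (M : Carrier) (k : ℕ) (s : State) : Set c where
      field
        inputs   : Inputs n ξ η k s
        {i}      : ℕ
        i+k≡1+n  : i ℕ.+ k ≡ suc n
        base     : regs s 3 ≡ suc n
        position : regs s 4 ≡ i
        offset   : getReal (3 [ 1 ]) s ≡ M
        front    : ∀ p q → p ℕ.+ q ≡ n → p ℕ.< i → reals s 2 p ≡ ξ q
        back     : ∀ q → k ℕ.≤ q → q ℕ.≤ n → reals s 2 (suc n ℕ.+ q) ≡ M - η q

    record Differentiated (m : ℕ) (Q : ℕ → Carrier) (k : ℕ) (s : State) : Set c where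
      field
        size        : regs s 0 ≡ m
        counter     : Counting k s
        points      : reals s 2 ≡ Q
        differences : ∀ j → k ℕ.≤ j → j ℕ.< m → reals s 0 j ≡ Q (suc j) - Q j

    record Transformed (n : ℕ) (ξ η : ℕ → Carrier) (s : State) : Set (c L.⊔ ℓ₂) where
      field
        {B}         : Carrier
        {Q}         : ℕ → Carrier
        bound       : BoundFor n ξ η 0 B
        points      : Points n ξ η ((B + B) + (B + B)) Q
        size        : regs s 0 ≡ suc n ℕ.+ suc n
        differences : ∀ j → j ℕ.< suc n ℕ.+ suc n → reals s 0 j ≡ Q (suc j) - Q j

    module _ {n : ℕ} {ξ η : ℕ → Carrier} where

      raiseBound-preserves : ∀ {k s} → Bounded n ξ η (suc k) s → Runs raiseBound s 11 (Bounded n ξ η k)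
      raiseBound-preserves {k} {s} inv =
        block-executes (opᵢ monus 2 2 1 ∷ []) >>= λ { refl →
        raiseToAbs-runs (0 [ 2 ]) null (λ _ → refl) >>= λ {s₁} r₁ →
        let open Raised r₁ renaming (bounds to bounds₀; grows to grows₀)
            remaining₁ = trans (cong (λ ρ → ρ 2) regs-kept) (cong₂ _∸_ remaining one)
        in runs-map (raiseToAbs-runs (1 [ 2 ]) {s₁}
             (trans (cong₂ (λ f ρ → f (ρ 1)) array₄-kept regs-kept) null) (λ _ → refl)) λ {s₂} r₂ →
        let module r₂ = Raised r₂
            regs-kept₂ = trans r₂.regs-kept regs-kept
            B≤ = ≤-trans grows₀ r₂.grows
        in record
        { inputs = record
          { size    = trans (cong (λ ρ → ρ 0) regs-kept₂) size
          ; counter = counting (trans (cong (λ ρ → ρ 1) regs-kept₂) one)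
                               (trans (cong (λ ρ → ρ 2) r₂.regs-kept) remaining₁)
          ; array₀  = trans r₂.array₀-kept (trans array₀-kept array₀)
          ; array₁  = trans r₂.array₁-kept (trans array₁-kept array₁)
          }
        ; null  = trans (cong₂ (λ f ρ → f (ρ 1)) (trans r₂.array₄-kept array₄-kept) regs-kept₂) null
        ; bound = record
          { nonNegative = ≤-trans nonNegative B≤
          ; bounds      = λ j k≤j j≤n → case ℕₚ.m≤n⇒m<n∨m≡n k≤j of λ
            { (inj₁ k<j)  → let bx , by = bounds j k<j j≤n in bound-mono B≤ bx , bound-mono B≤ by
            ; (inj₂ refl) →
              subst (IsBoundFor _) (cong₂ (λ f i → f i) array₀ (cong₂ _∸_ remaining one))
                (bound-mono r₂.grows bounds₀) ,
              subst (IsBoundFor _) (cong₂ (λ f i → f i) (trans array₁-kept array₁) remaining₁) r₂.bounds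
            }
          }
        } }
        where
        open Bounded inv using (inputs; null) renaming (bound to bound₀)
        open BoundFor bound₀
        open Inputs inputs
        open Counting counter

      arrange-preserves : ∀ {M k s} → Arranged n ξ η M (suc k) s → Arranged n ξ η M k (execs arrange s)
      arrange-preserves {M} {k} {s} inv = record
        { inputs   = record { size = size ; counter = counting one remaining′ ; array₀ = array₀ ; array₁ = array₁ }
        ; i+k≡1+n  = trans (sym (ℕₚ.+-suc i k)) i+k≡1+n
        ; base     = base
        ; position = cong₂ ℕ._+_ one position
        ; offset   = offset
        ; front    = front′
        ; back     = back′
        }
        where
        open Arranged inv
        open Inputs inputs
        open Counting counter
        remaining′ : regs s 2 ∸ regs s 1 ≡ k
        remaining′ = cong₂ _∸_ remaining one
        backPosition : regs s 3 ℕ.+ (regs s 2 ∸ regs s 1) ≡ suc n ℕ.+ k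
        backPosition = cong₂ ℕ._+_ base remaining′
        i+k≡n : i ℕ.+ k ≡ n
        i+k≡n = ℕₚ.suc-injective (trans (sym (ℕₚ.+-suc i k)) i+k≡1+n)
        A₂ : ℕ → Carrier
        A₂ = reals s 2 [ regs s 4 ↦ reals s 0 (regs s 2 ∸ regs s 1) ]
        front′ : ∀ p q → p ℕ.+ q ≡ n → p ℕ.< suc i → reals (execs arrange s) 2 p ≡ ξ q
        front′ p q p+q≡n p<1+i = trans
          (update-off A₂ _ backPosition (ℕₚ.>⇒≢ (s≤s (ℕₚ.≤-trans (m+n≡o⇒m≤o p+q≡n) (ℕₚ.m≤m+n n k)))))
          (case ℕₚ.m<1+n⇒m<n∨m≡n p<1+i of λ
            { (inj₁ p<i)  → trans (update-off (reals s 2) _ position (ℕₚ.>⇒≢ p<i)) (front p q p+q≡n p<i)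
            ; (inj₂ refl) → trans (update-at (reals s 2) _ position)
                (cong₂ (λ f j → f j) array₀ (trans remaining′ (ℕₚ.+-cancelˡ-≡ p k q (trans i+k≡n (sym p+q≡n)))))
            })
        back′ : ∀ q → k ℕ.≤ q → q ℕ.≤ n → reals (execs arrange s) 2 (suc n ℕ.+ q) ≡ M - η q
        back′ q k≤q q≤n = case ℕₚ.m≤n⇒m<n∨m≡n k≤q of λ
          { (inj₂ refl) → trans (update-at A₂ _ backPosition)
            (cong₂ _-_ offset (cong₂ (λ f j → f j) array₁ remaining′))
          ; (inj₁ k<q)  → trans
            (update-off A₂ _ backPosition (ℕₚ.<⇒≢ (ℕₚ.+-monoʳ-< (suc n) k<q)))
            (trans (update-off (reals s 2) _ position (ℕₚ.<⇒≢ (s≤s (ℕₚ.≤-trans (m+n≡o⇒m≤o i+k≡n) (ℕₚ.m≤m+n n q)))))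
                   (back q k<q q≤n))
          }

      arranged : ∀ {M s} → Arranged n ξ η M 0 s → Points n ξ η M (reals (execs initialise₃ s) 2)
      arranged {M} {s} inv = record
        { front = λ p q p+q≡n →
            let p≤n = m+n≡o⇒m≤o p+q≡n in
            trans (update-off (reals s 2) _ end (ℕₚ.>⇒≢ (s≤s (ℕₚ.≤-trans p≤n (ℕₚ.m≤m+n n (suc n))))))
                  (front p q p+q≡n (subst (p ℕ.<_) (trans (sym i+k≡1+n) (ℕₚ.+-identityʳ i)) (s≤s p≤n)))
        ; back  = λ q q≤n →
            trans (update-off (reals s 2) _ end (ℕₚ.>⇒≢ (ℕₚ.+-monoʳ-< (suc n) (s≤s q≤n))))
                  (back q z≤n q≤n)
        ; final = trans (update-at (reals s 2) _ end) (cong₂ _-_ (cong₂ (λ f j → f j) array₀ size) offset)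
        }
        where
        open Arranged inv
        open Inputs inputs
        end : regs s 3 ℕ.+ regs s 3 ≡ suc n ℕ.+ suc n
        end = cong₂ ℕ._+_ base base

    differentiate-preserves : ∀ {m Q k s} → Differentiated m Q (suc k) s →
                              Differentiated m Q k (execs differentiate s)
    differentiate-preserves {m} {Q} {k} {s} inv = record
      { size        = size
      ; counter     = counting one remaining′
      ; points      = points
      ; differences = λ j k≤j j<m → case ℕₚ.m≤n⇒m<n∨m≡n k≤j of λ
        { (inj₁ k<j)  → trans (update-off (reals s 0) _ remaining′ (ℕₚ.<⇒≢ k<j)) (differences j k<j j<m)
        ; (inj₂ refl) → trans (update-at (reals s 0) _ remaining′)
            (cong₂ _-_ (cong₂ (λ f i → f i) points (cong₂ ℕ._+_ one remaining′))
                       (cong₂ (λ f i → f i) points remaining′))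
        }
      }
      where
      open Differentiated inv
      open Counting counter
      remaining′ : regs s 2 ∸ regs s 1 ≡ k
      remaining′ = cong₂ _∸_ remaining one

    transformTime : ℕ → ℕ
    transformTime n = 4 ℕ.+ ((suc n ℕ.* 12 ℕ.+ 1) ℕ.+ (5 ℕ.+ ((suc n ℕ.* 6 ℕ.+ 1) ℕ.+
                      (4 ℕ.+ ((suc n ℕ.+ suc n) ℕ.* 4 ℕ.+ 1)))))

    transform-runs : ∀ {n s} → regs s 0 ≡ n →
                     Runs transform s (transformTime n)
                       (Transformed n (reals s 0) (reals s 1))
    transform-runs {n} {s} size =
      block-runs initialise₁ initialised₁ >>= λ inv →
      countdown-runs (Bounded n ξ η) (Inputs.counter ∘ Bounded.inputs)
        raiseBound-preserves (suc n) inv >>= λ {s₁} bounded →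
      let B = getReal (3 [ 1 ]) s₁
          M = (B + B) + (B + B)
      in
      block-runs initialise₂ {Q = Arranged n ξ η M (suc n)} (initialised₂ bounded) >>= λ inv →
      countdown-runs (Arranged n ξ η M) (Inputs.counter ∘ Arranged.inputs)
        (block-runs arrange ∘ arrange-preserves) (suc n) inv >>= λ {s₂} inv →
      let Q = reals (execs initialise₃ s₂) 2
          m = suc n ℕ.+ suc n
      in
      block-runs initialise₃ {Q = Differentiated m Q m} (initialised₃ inv) >>= λ differentiated →
      runs-map
        (countdown-runs (Differentiated m Q) Differentiated.counter
          (block-runs differentiate ∘ differentiate-preserves) m differentiated)
        λ done → record
          { bound       = Bounded.bound bounded
          ; points      = arranged inv
          ; size        = Differentiated.size done
          ; differences = λ j → Differentiated.differences done j z≤n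
          }
      where
      ξ η : ℕ → Carrier
      ξ = reals s 0
      η = reals s 1
      initialised₁ : Bounded n ξ η (suc n) (execs initialise₁ s)
      initialised₁ = record
        { inputs = record { size = size ; counter = counting refl (cong suc size) ; array₀ = refl ; array₁ = refl }
        ; null   = refl
        ; bound  = record { nonNegative = ≤-refl ; bounds = λ j n<j j≤n → ⊥-elim (ℕₚ.<⇒≱ n<j j≤n) }
        }
      initialised₂ : ∀ {s₁} → Bounded n ξ η 0 s₁ → let B = getReal (3 [ 1 ]) s₁ in
                     Arranged n ξ η ((B + B) + (B + B)) (suc n) (execs initialise₂ s₁)
      initialised₂ {s₁} bounded = record
        { inputs   = record
          { size    = size′
          ; counter = counting one (cong₂ ℕ._+_ one size′)
          ; array₀  = array₀
          ; array₁  = array₁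
          }
        ; i+k≡1+n  = refl
        ; base     = cong₂ ℕ._+_ one size′
        ; position = refl
        ; offset   = trans (update-at (reals s₁ 3 [ regs s₁ 1 ↦ 2B ]) {regs s₁ 1} _ refl)
                           (cong₂ _+_ doubled doubled)
        ; front    = λ p q _ ()
        ; back     = λ q n<q q≤n → ⊥-elim (ℕₚ.<⇒≱ n<q q≤n)
        }
        where
        open Inputs (Bounded.inputs bounded) renaming (size to size′)
        open Counting counter
        2B = getReal (3 [ 1 ]) s₁ + getReal (3 [ 1 ]) s₁
        doubled = update-at (reals s₁ 3) {regs s₁ 1} 2B refl
      initialised₃ : ∀ {M s₂} → Arranged n ξ η M 0 s₂ → let m = suc n ℕ.+ suc n in
                     Differentiated m (reals (execs initialise₃ s₂) 2) m (execs initialise₃ s₂)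
      initialised₃ inv = record
        { size        = cong₂ ℕ._+_ base base
        ; counter     = counting one (cong₂ ℕ._+_ base base)
        ; points      = refl
        ; differences = λ j m≤j j<m → ⊥-elim (ℕₚ.<⇒≱ j<m m≤j)
        }
        where
        open Arranged inv
        open Inputs inputs
        open Counting counter

    prepare subtract unpair : List Instr
    -- The number 2n + 1 put into register 2 is both the position of the sum of the whole sequence
    -- and the number of entries of the convolution.
    prepare  = constᵢ 1 1 ∷ opᵢ monus 2 0 1 ∷
               zeroᵣ (1 [ 1 ]) ∷ opᵣ sub (1 [ 1 ]) (1 [ 1 ]) (0 [ 2 ]) ∷ constᵢ 3 0 ∷ []
    subtract = opᵢ monus 2 2 1 ∷ opᵣ sub (0 [ 2 ]) (1 [ 1 ]) (0 [ 2 ]) ∷ []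
    unpair   = opᵢ monus 0 0 1 ∷ opᵢ add 3 1 3 ∷ []

    -- The last loop turns (2 + 2 n , 0) in registers 0 and 3 into (n , 2 + n).
    recover : Prog
    recover = block prepare ⨾ countdown (block subtract) ⨾ while (3 ≤ᵢ 0) repeat block unpair

    record Subtracted (n : ℕ) (ω : ℕ → Carrier) (k : ℕ) (s : State) : Set c where
      field
        size      : regs s 0 ≡ suc n ℕ.+ suc n
        counter   : Counting k s
        position  : regs s 3 ≡ 0
        offset    : getReal (1 [ 1 ]) s ≡ 0# - ω (n ℕ.+ suc n)
        unread    : ∀ j → j ℕ.< k → reals s 0 j ≡ ω j
        recovered : ∀ j → k ℕ.≤ j → j ℕ.< n ℕ.+ suc n → reals s 0 j ≡ (0# - ω (n ℕ.+ suc n)) - ω j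

    subtract-preserves : ∀ {n ω k s} → Subtracted n ω (suc k) s → Subtracted n ω k (execs subtract s)
    subtract-preserves {n} {ω} {k} {s} inv = record
      { size      = size
      ; counter   = counting one remaining′
      ; position  = position
      ; offset    = offset
      ; unread    = λ j j<k → trans (update-off (reals s 0) _ remaining′ (ℕₚ.>⇒≢ j<k))
                                  (unread j (ℕₚ.m<n⇒m<1+n j<k))
      ; recovered = λ j k≤j j<m → case ℕₚ.m≤n⇒m<n∨m≡n k≤j of λ
        { (inj₁ k<j)  → trans (update-off (reals s 0) _ remaining′ (ℕₚ.<⇒≢ k<j)) (recovered j k<j j<m)
        ; (inj₂ refl) → trans (update-at (reals s 0) _ remaining′)
            (cong₂ _-_ offset (trans (cong (reals s 0) remaining′) (unread k ℕₚ.≤-refl)))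
        }
      }
      where
      open Subtracted inv
      open Counting counter
      remaining′ : regs s 2 ∸ regs s 1 ≡ k
      remaining′ = cong₂ _∸_ remaining one

    -- Index arithmetic offers only addition and truncated subtraction, so n is obtained from 2n + 2
    -- by moving two counters towards each other. With `i` = 2 + n - k the loop test `i` ≤ n + k
    -- holds exactly for k ≥ 1, so the loop stops with n in register 0.
    record Unpaired (n : ℕ) (ω : ℕ → Carrier) (k : ℕ) (s : State) : Set c where
      field
        {i}       : ℕ
        i+k≡2+n   : i ℕ.+ k ≡ 2 ℕ.+ n
        size      : regs s 0 ≡ n ℕ.+ k
        one       : regs s 1 ≡ 1
        position  : regs s 3 ≡ i
        recovered : ∀ j → j ℕ.< n ℕ.+ suc n → reals s 0 j ≡ (0# - ω (n ℕ.+ suc n)) - ω j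

    unpair-runs : ∀ {n ω s} → Unpaired n ω (2 ℕ.+ n) s →
                  Runs (while (3 ≤ᵢ 0) repeat block unpair) s ((2 ℕ.+ n) ℕ.* 3 ℕ.+ 1) (Unpaired n ω 0)
    unpair-runs {n} {ω} =
      while-runs (Unpaired n ω) (λ inv → holds inv , block-runs unpair (preserves inv)) fails (2 ℕ.+ n)
      where
      i≤1+n : ∀ {i k} → i ℕ.+ suc k ≡ 2 ℕ.+ n → i ℕ.≤ suc n
      i≤1+n {i} {k} i+1+k≡2+n = m+n≡o⇒m≤o (ℕₚ.suc-injective (trans (sym (ℕₚ.+-suc i k)) i+1+k≡2+n))
      holds : ∀ {k s} → Unpaired n ω (suc k) s → Holds s (3 ≤ᵢ 0)
      holds {k} inv = ≤ᵢ-holds (subst₂ ℕ._≤_ (sym position) (sym (trans size (ℕₚ.+-suc n k)))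
        (ℕₚ.≤-trans (i≤1+n i+k≡2+n) (s≤s (ℕₚ.m≤m+n n k))))
        where open Unpaired inv
      preserves : ∀ {k s} → Unpaired n ω (suc k) s → Unpaired n ω k (execs unpair s)
      preserves {k} inv = record
        { i+k≡2+n   = trans (sym (ℕₚ.+-suc i k)) i+k≡2+n
        ; size      = trans (cong₂ _∸_ size one) (cong ℕ.pred (ℕₚ.+-suc n k))
        ; one       = one
        ; position  = cong₂ ℕ._+_ one position
        ; recovered = recovered
        }
        where open Unpaired inv
      fails : ∀ {s} → Unpaired n ω 0 s → ¬ Holds s (3 ≤ᵢ 0)
      fails inv (≤ᵢ-holds i≤n+0) = ℕₚ.<⇒≱ (ℕₚ.n<1+n n) (ℕₚ.<⇒≤ (subst₂ ℕ._≤_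
        (trans position (trans (sym (ℕₚ.+-identityʳ i)) i+k≡2+n)) (trans size (ℕₚ.+-identityʳ n)) i≤n+0))
        where open Unpaired inv

    recover-runs : ∀ {n s} → regs s 0 ≡ suc n ℕ.+ suc n →
                   Runs recover s (5 ℕ.+ (((n ℕ.+ suc n) ℕ.* 3 ℕ.+ 1) ℕ.+ ((2 ℕ.+ n) ℕ.* 3 ℕ.+ 1)))
                     (Unpaired n (reals s 0) 0)
    recover-runs {n} {s} size =
      block-runs prepare prepared >>= λ inv →
      countdown-runs (Subtracted n ω) Subtracted.counter
        (block-runs subtract ∘ subtract-preserves) (n ℕ.+ suc n) inv >>=
      unpair-runs ∘ subtracted
      where
      ω : ℕ → Carrier
      ω = reals s 0
      last : regs s 0 ∸ 1 ≡ n ℕ.+ suc n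
      last = cong (_∸ 1) size
      prepared : Subtracted n ω (n ℕ.+ suc n) (execs prepare s)
      prepared = record
        { size      = size
        ; counter   = counting refl last
        ; position  = refl
        ; offset    = cong (λ j → 0# - ω j) last
        ; unread    = λ j _ → refl
        ; recovered = λ j m≤j j<m → ⊥-elim (ℕₚ.<⇒≱ j<m m≤j)
        }
      subtracted : ∀ {s′} → Subtracted n ω 0 s′ → Unpaired n ω (2 ℕ.+ n) s′
      subtracted inv = record
        { i+k≡2+n   = refl
        ; size      = trans size′ (sym (ℕₚ.+-suc n (suc n)))
        ; one       = Counting.one counter
        ; position  = position
        ; recovered = λ j → recovered j z≤n
        }
        where open Subtracted inv renaming (size to size′)

-- From reductions to time bounds.

module _ {c ℓ₁ ℓ₂} (R : OrderedField c ℓ₁ ℓ₂) where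

  open RealRAM R

  -- The programs compose because `recover` is correct from every memory that stores a solution, in
  -- particular from the one the solver leaves. The constant is doubled to pay for both `transform`
  -- and `recover`. Since `T` may fail to be monotone, the solver's time on size m is bounded by the
  -- maximum of `T`.
  reduction⇒≲ : ∀ {P Q} → LinearReduction P Q → P ≲ Q
  reduction⇒≲ {P} {Q} red = constant ℕ.+ constant , λ T (solver , solves) →
    transform ⨾ solver ⨾ recover , λ {n} x s input →
      let m , y , t , s′ , m≤ , transform⇓ , t≤ , input′ , recovers = correct x s input
          t′ , s″ , z , solver⇓ , t′≤ , output , solution           = solves y s′ input′
          w , u , r , recover⇓ , u≤ , output′ , solution′           = recovers z solution s″ output
          D   = constant ℕ.* suc n
          U   = maxUpTo T ((constant ℕ.+ constant) ℕ.* suc n)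
          C≡  = ℕₚ.*-distribʳ-+ (suc n) constant constant
          m≤C = ℕₚ.≤-trans m≤ (ℕₚ.≤-trans (ℕₚ.m≤m+n D D) (ℕₚ.≤-reflexive (sym C≡)))
      in t ℕ.+ (t′ ℕ.+ u) , r , w , seq transform⇓ (seq solver⇓ recover⇓) ,
         (begin
           t ℕ.+ (t′ ℕ.+ u)
             ≤⟨ ℕₚ.+-mono-≤ t≤ (ℕₚ.+-mono-≤ (ℕₚ.≤-trans t′≤ (maxUpTo-upper T _ m≤C)) u≤) ⟩
           D ℕ.+ (U ℕ.+ D)                          ≡⟨ rearrange D U ⟩
           U ℕ.+ (D ℕ.+ D)                          ≡⟨ cong (U ℕ.+_) C≡ ⟨
           U ℕ.+ (constant ℕ.+ constant) ℕ.* suc n  ∎) ,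
         output′ , solution′
    where
    open LinearReduction red
    open ℕₚ.≤-Reasoning
    rearrange : ∀ d e → d ℕ.+ (e ℕ.+ d) ≡ e ℕ.+ (d ℕ.+ d)
    rearrange = solve-∀

-- Arithmetic correctness of the two reductions.

module Reductions {c ℓ₁ ℓ₂} (R : OrderedField c ℓ₁ ℓ₂) where

  open OrderedFieldProperties R
  open RealRAM R
  open State
  open Machine R
  open CommutativeMonoidSolver +-commutativeMonoid using (solve; _⊕_; _⊜_)
  open ≤-Reasoning hiding (start)

  IsMax-resp-≈ : ∀ {I f m m′} → m ≈ m′ → IsMax {I} f m → IsMax f m′
  IsMax-resp-≈ m≈m′ ((i , m≈fi) , f≤m) = (i , ≈-trans (≈-sym m≈m′) m≈fi) , λ i → ≤-respʳ-≈ m≈m′ (f≤m i)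

  IsMin-resp-≈ : ∀ {I f m m′} → m ≈ m′ → IsMin {I} f m → IsMin f m′
  IsMin-resp-≈ m≈m′ ((i , m≈fi) , m≤f) = (i , ≈-trans (≈-sym m≈m′) m≈fi) , λ i → ≤-respˡ-≈ m≈m′ (m≤f i)

  -- `Q` is any sequence with differences `a`, so this applies both to prefix sums and to the
  -- arranged points, which do not start at zero.
  blockSum-telescopes : ∀ {n} (a : Vector Carrier n) (Q : ℕ → Carrier) →
                        (∀ i → a i + Q (toℕ i) ≈ Q (suc (toℕ i))) →
                        ∀ ℓ ((p , p+ℓ≤n) : Start n ℓ) → blockSum a ℓ (p , p+ℓ≤n) + Q p ≈ Q (p ℕ.+ ℓ)
  blockSum-telescopes a Q step ℓ (p , p+ℓ≤n) = ≈-trans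
    (+-congˡ (≈-reflexive (cong Q (sym (ℕₚ.+-identityʳ p)))))
    (sum-telescopes (λ j → a (inject≤ (p ↑ʳ j) p+ℓ≤n)) (λ t → Q (p ℕ.+ t)) shifted)
    where
    shifted : ∀ j → a (inject≤ (p ↑ʳ j) p+ℓ≤n) + Q (p ℕ.+ toℕ j) ≈ Q (p ℕ.+ suc (toℕ j))
    shifted j = begin-equality
      a i + Q (p ℕ.+ toℕ j)  ≡⟨ cong (λ t → a i + Q t) i≡ ⟨
      a i + Q (toℕ i)        ≈⟨ step i ⟩
      Q (suc (toℕ i))        ≡⟨ cong (Q ∘ suc) i≡ ⟩
      Q (suc (p ℕ.+ toℕ j))  ≡⟨ cong Q (ℕₚ.+-suc p (toℕ j)) ⟨
      Q (p ℕ.+ suc (toℕ j))  ∎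
      where
      i = inject≤ (p ↑ʳ j) p+ℓ≤n
      i≡ : toℕ i ≡ p ℕ.+ toℕ j
      i≡ = trans (toℕ-inject≤ (p ↑ʳ j) p+ℓ≤n) (toℕ-↑ʳ p j)

  -- Convolution of prefix sums yields maximal block sums.

  module _ where
    open MCSP-to-Convolution

    -- Blocks of length l + 1 correspond to splits of n + 1 + l: the block starting at p gives i = p
    -- + l + 1 and j = n - p, and i ≤ n says that the block fits. Under this correspondence x_i +
    -- y_j is the negated block sum, so the minimum is the negated maximum.
    convolution-maximises : ∀ {n} (α : ℕ → Carrier) (a : Vector Carrier n) → (∀ i → α (toℕ i) ≈ a i) →
      let x = λ (i : Fin (suc n)) → 0# - prefixSum α (toℕ i)
          y = λ (j : Fin (suc n)) → prefixSum α (n ∸ toℕ j)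
      in ∀ l ζ → IsMin {Split n (suc n ℕ.+ l)} (λ ((i , j) , _) → x i + y j) ζ →
         IsMax (blockSum a (suc l)) (0# - ζ)
    convolution-maximises {n} α a α≈a l ζ ((((i , j) , i+j≡) , ζ≈) , ζ≤) =
      (start , ≈-trans (+-identityˡ (- ζ)) (≈-sym (-‿uniqueˡ _ ζ attained))) ,
      upper
      where
      S = prefixSum α
      telescopes : (b : Start n (suc l)) → let (p , _) = b in blockSum a (suc l) b + S p ≈ S (p ℕ.+ suc l)
      telescopes = blockSum-telescopes a S
        (λ i → ≈-trans (+-comm _ _) (+-congˡ (≈-sym (α≈a i)))) (suc l)
      cancels : (b : Start n (suc l)) → let (p , _) = b in
                ((0# - S (p ℕ.+ suc l)) + S p) + blockSum a (suc l) b ≈ 0#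
      cancels b@(p , _) = begin-equality
        ((0# - S (p ℕ.+ suc l)) + S p) + blockSum a (suc l) b
          ≈⟨ solve 3 (λ u v w → (u ⊕ v) ⊕ w ⊜ u ⊕ (w ⊕ v)) ≈-refl _ _ _ ⟩
        (0# - S (p ℕ.+ suc l)) + (blockSum a (suc l) b + S p)  ≈⟨ +-congˡ (telescopes b) ⟩
        (0# - S (p ℕ.+ suc l)) + S (p ℕ.+ suc l)               ≈⟨ x-z+z≈x 0# _ ⟩
        0#                                                     ∎
      rearrange : ∀ p l j → (p ℕ.+ suc l) ℕ.+ j ≡ suc (p ℕ.+ j) ℕ.+ l
      rearrange = solve-∀
      j≤n = toℕ≤pred[n] j
      end≡ : (n ∸ toℕ j) ℕ.+ suc l ≡ toℕ i
      end≡ = ℕₚ.+-cancelʳ-≡ (toℕ j) _ _ (trans (rearrange (n ∸ toℕ j) l (toℕ j))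
        (trans (cong (λ t → suc t ℕ.+ l) (ℕₚ.m∸n+n≡m j≤n)) (sym i+j≡)))
      start : Start n (suc l)
      start = n ∸ toℕ j , subst (ℕ._≤ n) (sym end≡) (toℕ≤pred[n] i)
      attained : blockSum a (suc l) start + ζ ≈ 0#
      attained = begin-equality
        blockSum a (suc l) start + ζ  ≈⟨ +-comm _ ζ ⟩
        ζ + blockSum a (suc l) start  ≈⟨ +-congʳ ζ≈ ⟩
        ((0# - S (toℕ i)) + S (n ∸ toℕ j)) + blockSum a (suc l) start
          ≡⟨ cong (λ t → ((0# - S t) + S (n ∸ toℕ j)) + blockSum a (suc l) start) end≡ ⟨
        ((0# - S (n ∸ toℕ j ℕ.+ suc l)) + S (n ∸ toℕ j)) + blockSum a (suc l) start
          ≈⟨ cancels start ⟩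
        0#                            ∎
      upper : (b : Start n (suc l)) → blockSum a (suc l) b ≤ 0# - ζ
      upper b@(p , p+ℓ≤n) = +-cancelʳ-≤ ζ (begin
        blockSum a (suc l) b + ζ
          ≤⟨ +-monoʳ-≤ _ (ζ≤ ((fromℕ< i<1+n , fromℕ< j<1+n) , split)) ⟩
        blockSum a (suc l) b + ((0# - S (toℕ (fromℕ< i<1+n))) + S (n ∸ toℕ (fromℕ< j<1+n)))
          ≡⟨ cong₂ (λ i j → blockSum a (suc l) b + ((0# - S i) + S j))
                   i≡ (trans (cong (n ∸_) j≡) (ℕₚ.m∸[m∸n]≡n p≤n)) ⟩
        blockSum a (suc l) b + ((0# - S (p ℕ.+ suc l)) + S p)  ≈⟨ +-comm _ _ ⟩
        ((0# - S (p ℕ.+ suc l)) + S p) + blockSum a (suc l) b  ≈⟨ cancels b ⟩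
        0#                                                     ≈⟨ x-z+z≈x 0# ζ ⟨
        (0# - ζ) + ζ                                           ∎)
        where
        p≤n = ℕₚ.≤-trans (ℕₚ.m≤m+n p (suc l)) p+ℓ≤n
        i<1+n : p ℕ.+ suc l ℕ.< suc n
        i<1+n = s≤s p+ℓ≤n
        j<1+n : n ∸ p ℕ.< suc n
        j<1+n = s≤s (ℕₚ.m∸n≤m n p)
        i≡ = toℕ-fromℕ< i<1+n
        j≡ = toℕ-fromℕ< j<1+n
        split : toℕ (fromℕ< i<1+n) ℕ.+ toℕ (fromℕ< j<1+n) ≡ suc n ℕ.+ l
        split = trans (cong₂ ℕ._+_ i≡ j≡)
          (trans (rearrange p l (n ∸ p)) (cong (λ t → suc t ℕ.+ l) (ℕₚ.m+[n∸m]≡n p≤n)))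

    MCSP-reduces : LinearReduction MCSP MinPlusConvolution
    MCSP-reduces = record
      -- The running time of `transform` is 8 + 7n; it determines the constant.
      { constant  = 8
      ; transform = transform
      ; recover   = recover
      ; correct   = correct
      }
      where
      t≤ : ∀ n → (5 ℕ.+ ((n ℕ.* 7 ℕ.+ 1) ℕ.+ 2)) ℕ.+ n ≡ 8 ℕ.* suc n
      t≤ = solve-∀
      u≤ : ∀ n → (5 ℕ.+ (n ℕ.* 4 ℕ.+ 1)) ℕ.+ (2 ℕ.+ 4 ℕ.* n) ≡ 8 ℕ.* suc n
      u≤ = solve-∀
      m≤ : ∀ n → n ℕ.+ (8 ℕ.+ 7 ℕ.* n) ≡ 8 ℕ.* suc n
      m≤ = solve-∀
      correct : ∀ {n} (a : Vector Carrier n) s → _ → _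
      correct {n} a s (size , stored) =
        let s′ , transform⇓ , done = transform-runs {n} {s} size
            module D = Transformed done
        in
        n , (x , y) , _ , s′ , m+n≡o⇒m≤o (m≤ n) , transform⇓ , m+n≡o⇒m≤o (t≤ n) ,
        (D.size , (λ i → ≈-reflexive (D.negated (toℕ i) (toℕ≤pred[n] i))) ,
                  (λ j → ≈-reflexive (D.reflected (n ∸ toℕ j) (toℕ j) (ℕₚ.m∸n+n≡m (toℕ≤pred[n] j))))) ,
        recovers
        where
        α = reals s 0
        x y : Vector Carrier (suc n)
        x i = 0# - prefixSum α (toℕ i)
        y j = prefixSum α (n ∸ toℕ j)
        recovers : ∀ z → _ → ∀ r → _ → _
        recovers z solution r (size′ , stored′) =
          let r′ , recover⇓ , done′ = recover-runs {n} {r} size′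
              module E = Shifted done′
          in
          w , _ , r′ , recover⇓ , m+n≡o⇒m≤o (u≤ n) ,
          (E.size , λ l → ≈-reflexive (E.recovered (toℕ l) z≤n (toℕ<n l))) ,
          λ l → convolution-maximises α a stored (toℕ l) _
            (subst (λ k → IsMin {Split n k} (λ ((i , j) , _) → x i + y j) (reals r 0 k)) (toℕ-fromℕ< (k< l))
              (IsMin-resp-≈ (≈-sym (stored′ (fromℕ< (k< l)))) (solution (fromℕ< (k< l)))))
          where
          -- The solution is built from the memory contents and not from `z`: the two agree only up
          -- to `≈`, and the program invariants speak about memory.
          w : Vector Carrier n
          w l = 0# - reals r 0 (suc n ℕ.+ toℕ l)
          k< : (l : Fin n) → suc n ℕ.+ toℕ l ℕ.< suc (2 ℕ.* n)
          k< l = s≤s (ℕₚ.+-monoʳ-< n (ℕₚ.<-≤-trans (toℕ<n l) (ℕₚ.m≤m+n n 0)))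

  -- Maximal block sums of the arranged points yield the convolution.

  module _ where
    open Convolution-to-MCSP

    data Position (n : ℕ) : ℕ → Set where
      front : ∀ p {i} → p ℕ.+ i ≡ n → Position n p
      back  : ∀ j → j ℕ.≤ n → Position n (suc n ℕ.+ j)
      final : Position n (suc n ℕ.+ suc n)

    position : ∀ n t → t ℕ.≤ suc n ℕ.+ suc n → Position n t
    position n t t≤m with t ℕ.≤? n
    ... | yes t≤n = front t (ℕₚ.m+[n∸m]≡n t≤n)
    ... | no  t≰n with ℕₚ.m≤n⇒m<n∨m≡n t≤m
    ...   | inj₂ refl = final
    ...   | inj₁ t<m  = subst (Position n) t≡ (back (t ∸ suc n)
      (ℕₚ.≤-pred (ℕₚ.+-cancelˡ-< (suc n) _ _ (subst (ℕ._< suc n ℕ.+ suc n) (sym t≡) t<m))))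
      where
      t≡ : suc n ℕ.+ (t ∸ suc n) ≡ t
      t≡ = ℕₚ.m+[n∸m]≡n (ℕₚ.≰⇒> t≰n)

    position-≤ : ∀ {n t} → Position n t → t ℕ.≤ suc n ℕ.+ suc n
    position-≤ {n} (front p p+i≡n) =
      ℕₚ.≤-trans (m+n≡o⇒m≤o p+i≡n) (ℕₚ.≤-trans (ℕₚ.n≤1+n n) (ℕₚ.m≤m+n (suc n) (suc n)))
    position-≤ {n} (back j j≤n) = ℕₚ.+-monoʳ-≤ (suc n) (ℕₚ.m≤n⇒m≤1+n j≤n)
    position-≤ final = ℕₚ.≤-refl

    -- This supplies a crossing block of length k + 1 to compare with when the maximum is attained
    -- by a block of another kind.
    split-exists : ∀ n k → k ℕ.≤ n ℕ.+ n → ∃[ i ] ∃[ j ] i ℕ.≤ n × j ℕ.≤ n × i ℕ.+ j ≡ k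
    split-exists n k k≤2n with ℕₚ.≤-total k n
    ... | inj₁ k≤n = k , 0 , k≤n , z≤n , ℕₚ.+-identityʳ k
    ... | inj₂ n≤k = n , k ∸ n , ℕₚ.≤-refl , ℕₚ.m≤n+o⇒m∸n≤o k n k≤2n , ℕₚ.m+[n∸m]≡n n≤k

    module _ {n : ℕ} {ξ η : ℕ → Carrier} {B : Carrier} {Q : ℕ → Carrier}
             (bound : BoundFor n ξ η 0 B) (points : Points n ξ η ((B + B) + (B + B)) Q) where
      open BoundFor bound
      open Points points renaming (front to Q-front; back to Q-back; final to Q-final)

      M : Carrier
      M = (B + B) + (B + B)

      0≤M : 0# ≤ M
      0≤M = 0≤x+y (0≤x+y nonNegative nonNegative) (0≤x+y nonNegative nonNegative)

      boundξ : ∀ {i} → i ℕ.≤ n → IsBoundFor B (ξ i)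
      boundξ i≤n = proj₁ (bounds _ z≤n i≤n)

      boundη : ∀ {j} → j ℕ.≤ n → IsBoundFor B (η j)
      boundη j≤n = proj₂ (bounds _ z≤n j≤n)

      ξ+η≤ : ∀ {i j} → i ℕ.≤ n → j ℕ.≤ n → ξ i + η j ≤ B + B
      ξ+η≤ i≤n j≤n = +-mono-≤ (proj₁ (boundξ i≤n)) (proj₁ (boundη j≤n))

      back-point : ∀ {j} → j ℕ.≤ n → Q (suc n ℕ.+ j) + η j ≈ M
      back-point {j} j≤n = ≈-trans (+-congʳ (≈-reflexive (Q-back j j≤n))) (x-z+z≈x M (η j))

      final-point : Q (suc n ℕ.+ suc n) + M ≈ ξ n
      final-point = ≈-trans (+-congʳ (≈-reflexive Q-final)) (x-z+z≈x (ξ n) M)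

      crossing : ∀ {b p i j} → p ℕ.+ i ≡ n → j ℕ.≤ n → b + Q p ≈ Q (suc n ℕ.+ j) → b + (ξ i + η j) ≈ M
      crossing {b} {p} {i} {j} p+i≡n j≤n b+Qp≈ = begin-equality
        b + (ξ i + η j)      ≡⟨ cong (λ u → b + (u + η j)) (Q-front p i p+i≡n) ⟨
        b + (Q p + η j)      ≈⟨ +-assoc b (Q p) (η j) ⟨
        (b + Q p) + η j      ≈⟨ +-congʳ b+Qp≈ ⟩
        Q (suc n ℕ.+ j) + η j  ≈⟨ back-point j≤n ⟩
        M                    ∎

      -- Within the x half b is a difference of two x entries; within the y half the two M cancel
      -- and b is a difference of two y entries. If the block ends at the last point, b + M is a
      -- difference of x entries or b + 2M equals x_n + y_j, and M ≥ 0. The remaining orders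
      -- contradict `p < e`.
      crossing-or-small : ∀ {b p e} → p ℕ.< e → Position n p → Position n e → b + Q p ≈ Q e →
        (∃[ i ] ∃[ j ] p ℕ.+ i ≡ n × j ℕ.≤ n × e ≡ suc n ℕ.+ j × b + (ξ i + η j) ≈ M) ⊎ (b ≤ B + B)
      crossing-or-small {b} p<e (front p {i} p+i≡n) (front e {i′} e+i′≡n) eq =
        inj₂ (difference-≤ (boundξ (m+n≡o⇒n≤o p+i≡n)) (boundξ (m+n≡o⇒n≤o e+i′≡n))
          (≈-trans (+-congˡ (≈-reflexive (sym (Q-front p i p+i≡n))))
                   (≈-trans eq (≈-reflexive (Q-front e i′ e+i′≡n)))))
      crossing-or-small p<e (front p {i} p+i≡n) (back j j≤n) eq =
        inj₁ (i , j , p+i≡n , j≤n , refl , crossing p+i≡n j≤n eq)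
      crossing-or-small {b} p<e (front p {i} p+i≡n) final eq =
        inj₂ (≤-trans (x≤x+y b 0≤M) (difference-≤ (boundξ (m+n≡o⇒n≤o p+i≡n)) (boundξ ℕₚ.≤-refl) (begin-equality
          (b + M) + ξ i                ≡⟨ cong ((b + M) +_) (Q-front p i p+i≡n) ⟨
          (b + M) + Q p                ≈⟨ solve 3 (λ b m q → (b ⊕ m) ⊕ q ⊜ (b ⊕ q) ⊕ m) ≈-refl b M (Q p) ⟩
          (b + Q p) + M                ≈⟨ +-congʳ eq ⟩
          Q (suc n ℕ.+ suc n) + M      ≈⟨ final-point ⟩
          ξ n                          ∎)))
      crossing-or-small p<e (back j j≤n) (front e {i} e+i≡n) eq =
        ⊥-elim (ℕₚ.<⇒≱ p<e (ℕₚ.≤-trans (m+n≡o⇒m≤o e+i≡n) (ℕₚ.≤-trans (ℕₚ.n≤1+n n) (ℕₚ.m≤m+n (suc n) j))))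
      crossing-or-small {b} p<e (back j j≤n) (back j′ j′≤n) eq =
        inj₂ (difference-≤ (boundη j′≤n) (boundη j≤n) (+-cancelʳ (Q (suc n ℕ.+ j)) _ _ (begin-equality
          (b + η j′) + Q (suc n ℕ.+ j)  ≈⟨ solve 3 (λ b y q → (b ⊕ y) ⊕ q ⊜ (b ⊕ q) ⊕ y) ≈-refl b (η j′) _ ⟩
          (b + Q (suc n ℕ.+ j)) + η j′  ≈⟨ +-congʳ eq ⟩
          Q (suc n ℕ.+ j′) + η j′       ≈⟨ back-point j′≤n ⟩
          M                             ≈⟨ back-point j≤n ⟨
          Q (suc n ℕ.+ j) + η j         ≈⟨ +-comm _ _ ⟩
          η j + Q (suc n ℕ.+ j)         ∎)))
      crossing-or-small {b} p<e (back j j≤n) final eq = inj₂ (begin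
        b                                      ≤⟨ x≤x+y b (0≤x+y 0≤M 0≤M) ⟩
        b + (M + M)                            ≈⟨ +-congˡ (+-congʳ (back-point j≤n)) ⟨
        b + ((Q (suc n ℕ.+ j) + η j) + M)
          ≈⟨ solve 4 (λ b q y m → b ⊕ ((q ⊕ y) ⊕ m) ⊜ ((b ⊕ q) ⊕ m) ⊕ y) ≈-refl b _ (η j) M ⟩
        ((b + Q (suc n ℕ.+ j)) + M) + η j      ≈⟨ +-congʳ (+-congʳ eq) ⟩
        (Q (suc n ℕ.+ suc n) + M) + η j        ≈⟨ +-congʳ final-point ⟩
        ξ n + η j                              ≤⟨ ξ+η≤ ℕₚ.≤-refl j≤n ⟩
        B + B                                  ∎)
      crossing-or-small p<e final e eq = ⊥-elim (ℕₚ.<⇒≱ p<e (position-≤ e))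

      module _ (a : Vector Carrier (suc n ℕ.+ suc n)) (a≈ : ∀ t → a t ≈ Q (suc (toℕ t)) - Q (toℕ t)) where

        telescopes : ∀ ℓ (b : Start (suc n ℕ.+ suc n) ℓ) → blockSum a ℓ b + Q (proj₁ b) ≈ Q (proj₁ b ℕ.+ ℓ)
        telescopes = blockSum-telescopes a Q λ t → ≈-trans (+-congʳ (a≈ t)) (x-z+z≈x _ _)

        -- The x_n in the last point cancels against the first point, which is x_n too, leaving -M.
        totalSum : ∀ {ω} → IsMax (blockSum a (suc n ℕ.+ suc n)) ω → 0# - ω ≈ M
        totalSum {ω} (((p , p+m≤m) , ω≈) , _) = begin-equality
          0# - ω   ≈⟨ +-identityˡ (- ω) ⟩
          - ω      ≈⟨ -‿uniqueˡ M ω (≈-trans (+-comm M ω) (+-cancelʳ (ξ n) _ _ (begin-equality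
            (ω + M) + ξ n                ≈⟨ solve 3 (λ b m q → (b ⊕ m) ⊕ q ⊜ (b ⊕ q) ⊕ m) ≈-refl ω M (ξ n) ⟩
            (ω + ξ n) + M                ≡⟨ cong (λ u → (ω + u) + M) (trans (cong Q p≡0) (Q-front 0 n refl)) ⟨
            (ω + Q p) + M                ≈⟨ +-congʳ (+-congʳ ω≈) ⟩
            (blockSum a m (p , p+m≤m) + Q p) + M  ≈⟨ +-congʳ (telescopes m (p , p+m≤m)) ⟩
            Q (p ℕ.+ m) + M              ≡⟨ cong (λ t → Q (t ℕ.+ m) + M) p≡0 ⟩
            Q m + M                      ≈⟨ final-point ⟩
            ξ n                          ≈⟨ +-identityˡ (ξ n) ⟨
            0# + ξ n                     ∎))) ⟨
          M        ∎
          where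
          m = suc n ℕ.+ suc n
          -- Only one block has full length, so the maximum is its sum.
          p≡0 : p ≡ 0
          p≡0 = ℕₚ.n≤0⇒n≡0 (ℕₚ.+-cancelʳ-≤ m p 0 p+m≤m)

        module _ (x y : Vector Carrier (suc n))
                 (ξ≈x : ∀ i → ξ (toℕ i) ≈ x i) (η≈y : ∀ j → η (toℕ j) ≈ y j) where

          -- For the lower bound, a split i + j = k gives the block from point n - i to point n + 1
          -- + j, of length k + 1. For attainment, a crossing maximal block directly yields a split;
          -- otherwise its sum is small and a tie argument applies.
          maxima-convolve : ∀ k {ω} → k ℕ.≤ n ℕ.+ n → IsMax (blockSum a (suc k)) ω →
                            IsMin {Split n k} (λ ((i , j) , _) → x i + y j) (M - ω)
          maxima-convolve k {ω} k≤2n (((p , p+ℓ≤m) , ω≈) , ≤ω) = attained , lower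
            where
            lower : ∀ (ij : Split n k) → let ((i , j) , _) = ij in M - ω ≤ x i + y j
            lower ((i , j) , i+j≡k) = +-cancelʳ-≤ ω (begin
              (M - ω) + ω                ≈⟨ x-z+z≈x M ω ⟩
              M
                ≈⟨ crossing q+i≡n j≤n (≈-trans (telescopes (suc k) b) (≈-reflexive (cong Q end≡))) ⟨
              blockSum a (suc k) b + (ξ (toℕ i) + η (toℕ j))  ≤⟨ +-monoˡ-≤ _ (≤ω b) ⟩
              ω + (ξ (toℕ i) + η (toℕ j))  ≈⟨ +-congˡ (+-cong (ξ≈x i) (η≈y j)) ⟩
              ω + (x i + y j)            ≈⟨ +-comm ω _ ⟩
              (x i + y j) + ω            ∎)
              where
              i≤n = toℕ≤pred[n] i
              j≤n = toℕ≤pred[n] j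
              q = n ∸ toℕ i
              q+i≡n : q ℕ.+ toℕ i ≡ n
              q+i≡n = ℕₚ.m∸n+n≡m i≤n
              rearrange : ∀ q i j → q ℕ.+ suc (i ℕ.+ j) ≡ suc (q ℕ.+ i) ℕ.+ j
              rearrange = solve-∀
              end≡ : q ℕ.+ suc k ≡ suc n ℕ.+ toℕ j
              end≡ = trans (cong (λ k → q ℕ.+ suc k) (sym i+j≡k))
                (trans (rearrange q (toℕ i) (toℕ j)) (cong (λ t → suc t ℕ.+ toℕ j) q+i≡n))
              b : Start (suc n ℕ.+ suc n) (suc k)
              b = q , subst (ℕ._≤ suc n ℕ.+ suc n) (sym end≡) (ℕₚ.+-monoʳ-≤ (suc n) (ℕₚ.m≤n⇒m≤1+n j≤n))

            splitting : ∀ {i j} (i≤n : i ℕ.≤ n) (j≤n : j ℕ.≤ n) → i ℕ.+ j ≡ k →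
                        Σ (Split n k) λ ((i′ , j′) , _) → x i′ + y j′ ≈ ξ i + η j
            splitting i≤n j≤n i+j≡k =
              ((fromℕ< (s≤s i≤n) , fromℕ< (s≤s j≤n)) , trans (cong₂ ℕ._+_ i≡ j≡) i+j≡k) ,
              ≈-trans (+-cong (≈-sym (ξ≈x _)) (≈-sym (η≈y _))) (≈-reflexive (cong₂ (λ i j → ξ i + η j) i≡ j≡))
              where
              i≡ = toℕ-fromℕ< (s≤s i≤n)
              j≡ = toℕ-fromℕ< (s≤s j≤n)

            attained : Σ (Split n k) λ ((i , j) , _) → M - ω ≈ x i + y j
            attained with crossing-or-small (ℕₚ.m<m+n p (s≤s z≤n))
              (position n p (ℕₚ.≤-trans (ℕₚ.m≤m+n p (suc k)) p+ℓ≤m)) (position n _ p+ℓ≤m)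
              (telescopes (suc k) (p , p+ℓ≤m))
            ... | inj₁ (i , j , p+i≡n , j≤n , p+ℓ≡ , b+≈M) with splitting (m+n≡o⇒n≤o p+i≡n) j≤n i+j≡k
              where
              rearrange : ∀ p i j → suc (p ℕ.+ i) ℕ.+ j ≡ p ℕ.+ suc (i ℕ.+ j)
              rearrange = solve-∀
              i+j≡k : i ℕ.+ j ≡ k
              i+j≡k = ℕₚ.suc-injective (ℕₚ.+-cancelˡ-≡ p _ _
                (trans (sym (rearrange p i j)) (trans (cong (λ t → suc t ℕ.+ j) p+i≡n) (sym p+ℓ≡))))
            ...   | ij , x+y≈ = ij , +-cancelʳ ω _ _ (begin-equality
              (M - ω) + ω        ≈⟨ x-z+z≈x M ω ⟩
              M                  ≈⟨ b+≈M ⟨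
              _ + (ξ i + η j)    ≈⟨ +-cong ω≈ x+y≈ ⟨
              ω + _              ≈⟨ +-comm ω _ ⟩
              _ + ω              ∎)
            -- Now ω ≤ 2B, and any split has x_i + y_j ≤ 2B, so x_i + y_j + ω ≤ 4B = M. With the
            -- lower bound this forces equality, whichever split is taken.
            attained | inj₂ b≤2B with split-exists n k k≤2n
            ... | i , j , i≤n , j≤n , i+j≡k with splitting i≤n j≤n i+j≡k
            ...   | ij , x+y≈ = ij , ≤-antisym (lower ij) (+-cancelʳ-≤ ω (begin
              _ + ω                  ≈⟨ +-congʳ x+y≈ ⟩
              (ξ i + η j) + ω        ≤⟨ +-mono-≤ (ξ+η≤ i≤n j≤n) (≤-respˡ-≈ (≈-sym ω≈) b≤2B) ⟩
              M                      ≈⟨ x-z+z≈x M ω ⟨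
              (M - ω) + ω            ∎))

    Convolution-reduces : LinearReduction MinPlusConvolution MCSP
    Convolution-reduces = record
      -- The running time of `transform` is 42 + 26n, and the constant is its value at n = 0.
      { constant  = 42
      ; transform = transform
      ; recover   = recover
      ; correct   = correct
      }
      where
      t≤ : ∀ n → (4 ℕ.+ ((suc n ℕ.* 12 ℕ.+ 1) ℕ.+ (5 ℕ.+ ((suc n ℕ.* 6 ℕ.+ 1) ℕ.+
                 (4 ℕ.+ ((suc n ℕ.+ suc n) ℕ.* 4 ℕ.+ 1)))))) ℕ.+ 16 ℕ.* n ≡ 42 ℕ.* suc n
      t≤ = solve-∀
      u≤ : ∀ n → (5 ℕ.+ (((n ℕ.+ suc n) ℕ.* 3 ℕ.+ 1) ℕ.+ ((2 ℕ.+ n) ℕ.* 3 ℕ.+ 1))) ℕ.+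
                 (26 ℕ.+ 33 ℕ.* n) ≡ 42 ℕ.* suc n
      u≤ = solve-∀
      m≤ : ∀ n → (suc n ℕ.+ suc n) ℕ.+ (40 ℕ.+ 40 ℕ.* n) ≡ 42 ℕ.* suc n
      m≤ = solve-∀
      correct : ∀ {n} (xy : Vector Carrier (suc n) × Vector Carrier (suc n)) s → _ → _
      correct {n} (x , y) s (size , storedx , storedy) =
        suc n ℕ.+ suc n , a , _ , proj₁ run ,
        m+n≡o⇒m≤o (m≤ n) , proj₁ (proj₂ run) , m+n≡o⇒m≤o (t≤ n) ,
        (D.size , λ t → ≈-reflexive (D.differences (toℕ t) (toℕ<n t))) ,
        recovers
        where
        run = transform-runs {n} {s} size
        module D = Transformed (proj₂ (proj₂ run))
        a : Vector Carrier (suc n ℕ.+ suc n)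
        a t = D.Q (suc (toℕ t)) - D.Q (toℕ t)
        recovers : ∀ w → _ → ∀ r → _ → _
        recovers w solution r (size′ , stored′) =
          let r′ , recover⇓ , done′ = recover-runs {n} {r} size′
              module E = Unpaired done′
          in
          z , _ , r′ , recover⇓ , m+n≡o⇒m≤o (u≤ n) ,
          (trans E.size (ℕₚ.+-identityʳ n) , λ k → ≈-reflexive (E.recovered (toℕ k) (k< k))) ,
          λ k → IsMin-resp-≈
            (+-congʳ (≈-sym (totalSum D.bound D.points a (λ _ → ≈-refl) (maximum (n ℕ.+ suc n) ℕₚ.≤-refl))))
            (maxima-convolve D.bound D.points a (λ _ → ≈-refl) x y storedx storedy (toℕ k)
              (ℕₚ.≤-pred (subst (toℕ k ℕ.<_) (ℕₚ.+-suc n n) (k< k)))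
              (maximum (toℕ k) (ℕₚ.m<n⇒m<1+n (k< k))))
          where
          z : Vector Carrier (suc (2 ℕ.* n))
          z k = (0# - reals r 0 (n ℕ.+ suc n)) - reals r 0 (toℕ k)
          k< : (k : Fin (suc (2 ℕ.* n))) → toℕ k ℕ.< n ℕ.+ suc n
          k< k = subst (toℕ k ℕ.<_)
            (trans (cong (λ t → suc (n ℕ.+ t)) (ℕₚ.+-identityʳ n)) (sym (ℕₚ.+-suc n n))) (toℕ<n k)
          maximum : ∀ l → l ℕ.< suc n ℕ.+ suc n → IsMax (blockSum a (suc l)) (reals r 0 l)
          maximum l l<m = subst (λ l → IsMax (blockSum a (suc l)) (reals r 0 l)) (toℕ-fromℕ< l<m)
            (IsMax-resp-≈ (≈-sym (stored′ (fromℕ< l<m))) (solution (fromℕ< l<m)))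

theorem1 : ∀ {c ℓ₁ ℓ₂} (R : OrderedField c ℓ₁ ℓ₂) →
    let open RealRAM R in
    LinearReduction MCSP MinPlusConvolution ×
    LinearReduction MinPlusConvolution MCSP ×
    (MCSP ≲ MinPlusConvolution) ×
    (MinPlusConvolution ≲ MCSP)
theorem1 R =
  MCSP-reduces , Convolution-reduces ,
  reduction⇒≲ R MCSP-reduces , reduction⇒≲ R Convolution-reduces
  where open Reductions R
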